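{- Let $P$ be the 3-ear and let $K,K'$ be proper pseudohexes such that $K$ is obtained from $K'$ by $P$-addition. (1) If $K$ has neither a $P$-obstacle nor a $P$-danger, then $P_K$ can be safely reduced. (2) If $K$ has a $P$-danger but not a $P$-bad, let $e$ be the $P$-no-edge with both endpoints in $V(h_x)\cup V(h_y)$ and let $g$ be the $P$-no-edge which has exactly one endpoint in $V(P_K)$, this endpoint lying in $V(h_z)$. Then there is a reduction of $P_K$ that creates no end, such that every contracted path but one contains at most one derived white edge of $K$, and the remaining contracted path contains exactly two derived white edges, namely $e$ and $g$.
   Context: Pseudohex. A pseudohex is a bipartite graph $K$ (parallel edges allowed, no loops) whose edges are coloured blue, red and white, which is either empty or satisfies: (i) the blue edges form vertex-disjoint 6-cycles covering $V(K)$, called the hexagons of $K$; if a hexagon is the 6-cycle $v_0v_1\cdots v_5v_0$ we write $\bar{v_i}=v_{i+3}$ (indices mod 6); (ii) for each vertex $x$, $\{x,\bar x\}$ is a red edge of $K$ (further red edges may exist); (iii) the white edges form a perfect matching of $K$. A white edge $e=\{x,y\}$ is real if $\bar e=\{\bar x,\bar y\}$ is also a white edge and the only red edges sharing a vertex with $e$ or $\bar e$ are $\{x,\bar x\}$ and $\{y,\bar y\}$; non-real white edges are derived. Two white edges are red-connected if some red edge is adjacent to both. An end is a red edge parallel to a white edge; $K$ has an end if it contains one. $G^K$ is the graph whose vertices are the hexagons of $K$, two hexagons being adjacent iff some pair of real white edges $e,\bar e$ joins them. $K$ is proper if it has no end and $G^K$ is 2-connected with no cycle of length 2. Reduction. Let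 $h$ be a hexagon and $N$ one of the two perfect matchings of its blue 6-cycle. For each edge of $N$, let $Q$ be the path formed by that edge and the two white edges adjacent to it. If $Q$ is not a cycle of length 2, add a new white edge $e_Q$ joining the end vertices of $Q$, and for each red edge $\{u,w\}$ with $w$ an interior vertex of $Q$ add a red edge $\{u,w'\}$ where $w'$ is the endpoint of $e_Q$ in the same bipartition class as $w$. If $Q$ is a cycle of length 2, then for each red edge $\{u,w\}$ with $w$ an interior vertex of $Q$ add a red edge $\{u,\bar u\}$. Finally delete the vertices of $h$. Reducing hexagons $h_1,\dots,h_l$ by perfect matchings $N_1,\dots,N_l$ means performing these reductions successively; its contracted paths are the components (paths and cycles) of the subgraph of $K$ formed by $N_1\cup\dots\cup N_l$ together with all white edges having an endpoint in $V(h_1)\cup\dots\cup V(h_l)$. The reduction is safe if every contracted path/cycle contains at most one derived white edge of $K$; a set of hexagons can be safely reduced if some choice of perfect matchings gives a safe reduction. The reduction creates an end if the resulting pseudohex has an end. 3-ear and addition. The 3-ear $P$ is the path $x z y$ (leaves $x,y$, centre $z$); the bold 3-ear has one half-edge at each of $x,y$. A graph is obtained from $G'$ by addition of the bold 3-ear if it is obtained from the disjoint union of $G'$ and $P$ by joining the two half-edges to two distinct vertices of degree 2 of $G'$. $K$ is obtained from $K'$ by $P$-addition if $G^K$ is obtained from $G^{K'}$ by addition of the bold 3-ear; $P_K=\{h_x,h_y,h_z\}$ is the set of hexagons of $K$ corresponding to $x,y,z$, and $V(P_K)$ the set of their vertices. $P$-no-edges are the derived white edges of $K$ with at least one endpoint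 in $V(P_K)$. $K$ has a $P$-obstacle if every $P$-no-edge has exactly one endpoint in $V(P_K)$. $K$ has a $P$-danger if: one $P$-no-edge has both endpoints in $V(h_x)\cup V(h_y)$; one $P$-no-edge has one endpoint in $V(h_x)\cup V(h_y)$ and the other in $V(h_z)$; and the remaining two $P$-no-edges each have exactly one endpoint in $V(P_K)$. $K$ has a $P$-bad if it has a $P$-danger and the $P$-no-edge with both endpoints in $V(h_x)\cup V(h_y)$ is red-connected to the $P$-no-edge that has exactly one endpoint in $V(P_K)$ with that endpoint in $V(h_z)$. -}

module Defs where

open import Data.Bool.Base using (Bool; not; if_then_else_)
open import Data.Empty using (⊥)
open import Data.Fin.Base using (Fin; toℕ)
open import Data.Fin.Patterns using (0F; 1F; 2F; 3F; 4F; 5F)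
open import Data.Fin.Properties using (_≟_)
open import Data.Fin.Subset using (Subset; _∈_; _-_)
open import Data.List.Base using (List; []; _∷_; foldl; map)
import Data.List.Membership.Propositional as List
open import Data.Nat.Base using (ℕ; _+_)
open import Data.Nat.DivMod using (_mod_)
open import Data.Product.Base using (Σ-syntax; ∃-syntax; _×_; _,_; proj₁; proj₂)
import Data.Product.Properties as Product
open import Data.Sum.Base using (_⊎_; inj₁; inj₂)
open import Data.Unit.Base using (⊤)
open import Function.Bundles using (_⇔_; _↔_; module Inverse)
open import Relation.Binary.Construct.Closure.ReflexiveTransitive using (Star)
open import Relation.Binary.Definitions using (DecidableEquality)
open import Relation.Binary.PropositionalEquality using (_≡_; _≢_)
open import Relation.Nullary.Decidable using (⌊_⌋)
open import Relation.Nullary.Negation using (¬_)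

private
  variable
    n n′ : ℕ

-- The blue edges of a pseudohex split its vertex set into 6-cycles.
-- Labelling each of these cyclically, a vertex is a pair (h , i): the
-- vertex vᵢ of the hexagon h.  The blue edges are then the pairs
-- {(h , i) , (h , i + 1)} with i taken modulo 6.

Vertex : ℕ → Set
Vertex n = Fin n × Fin 6

_≟ᵛ_ : DecidableEquality (Vertex n)
_≟ᵛ_ = Product.≡-dec _≟_ _≟_

next : Vertex n → Vertex n
next (h , i) = h , (toℕ i + 1) mod 6

bar : Vertex n → Vertex n
bar (h , i) = h , (toℕ i + 3) mod 6

-- Deleting vertices must not rename the remaining ones, so the hexagons
-- of a graph are a subset of a fixed set Fin n of labels.  The values of
-- side and mate on other labels carry no information.
--
-- The white edges are the pairs {v , mate v}, so a white edge is referred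
-- to by either of its two endpoints.  Red u v says that some red edge
-- joins u and v; the number of parallel red edges is never relevant.

record ColouredGraph (n : ℕ) : Set₁ where
  field
    hexagons : Subset n
    side     : Vertex n → Bool
    mate     : Vertex n → Vertex n
    Red      : Vertex n → Vertex n → Set

  _∈V : Vertex n → Set
  v ∈V = proj₁ v ∈ hexagons

open ColouredGraph public

-- The empty pseudohex is the case without hexagons.

record IsPseudohex (K : ColouredGraph n) : Set where
  field
    blue-bipartite  : ∀ v → (K ∈V) v → side K (next v) ≡ not (side K v)
    mate-∈V         : ∀ v → (K ∈V) v → (K ∈V) (mate K v)
    mate-involutive : ∀ v → (K ∈V) v → mate K (mate K v) ≡ v
    mate-bipartite  : ∀ v → (K ∈V) v → side K (mate K v) ≡ not (side K v)
    red-∈V          : ∀ {u v} → Red K u v → (K ∈V) u × (K ∈V) v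
    red-sym         : ∀ {u v} → Red K u v → Red K v u
    red-bipartite   : ∀ {u v} → Red K u v → side K v ≡ not (side K u)
    red-antipodal   : ∀ v → (K ∈V) v → Red K v (bar v)

module _ (K : ColouredGraph n) where

  -- u is an endpoint of the white edge at v.
  _On_ : Vertex n → Vertex n → Set
  u On v = u ≡ v ⊎ u ≡ mate K v

  -- Writing e = {v , mate v}, a red edge at a vertex w of e or ē is one of
  -- the two permitted ones exactly when it is {w , w̄}.
  Real : Vertex n → Set
  Real v = mate K (bar v) ≡ bar (mate K v)
         × (∀ w u → (w On v ⊎ w On (bar v)) → Red K w u → u ≡ bar w)

  Derived : Vertex n → Set
  Derived v = (K ∈V) v × ¬ Real v

  RedConnected : Vertex n → Vertex n → Set
  RedConnected e f = ∃[ s ] ∃[ t ] Red K s t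
                   × (s On e ⊎ t On e) × (s On f ⊎ t On f)

  HasEnd : Set
  HasEnd = ∃[ v ] (K ∈V) v × Red K v (mate K v)

record Graph : Set₁ where
  infix 4 _~_
  field
    V   : Set
    _~_ : V → V → Set

open Graph using (V)

record TwoConnected (G : Graph) : Set where
  open Graph G using (_~_)
  field
    three-vertices : ∃[ a ] ∃[ b ] ∃[ c ] a ≢ b × b ≢ c × _≢_ {A = V G} a c
    connected      : ∀ a b → Star _~_ a b
    no-cut-vertex  : ∀ c a b → a ≢ c → b ≢ c →
                     Star (λ p q → p ~ q × p ≢ c × q ≢ c) a b

Degree2 : (G : Graph) → V G → Set
Degree2 G u = ∃[ a ] ∃[ b ] a ≢ b × u ~ a × u ~ b × (∀ c → u ~ c → c ≡ a ⊎ c ≡ b)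
  where open Graph G using (_~_)

record _≅_ (G H : Graph) : Set where
  field
    bijection : V G ↔ V H
    adjacency : ∀ a b →
      Graph._~_ G a b ⇔ Graph._~_ H (Inverse.to bijection a) (Inverse.to bijection b)

module _ (K : ColouredGraph n) where

  -- The real white edge at v, which belongs to the pair e, ē, joins h to k.
  Joins : Vertex n → Fin n → Fin n → Set
  Joins v h k = Real K v × proj₁ v ≡ h × proj₁ (mate K v) ≡ k

  hexagonGraph : Graph
  hexagonGraph = record
    { V   = ∃[ h ] h ∈ hexagons K
    ; _~_ = λ (h , _) (k , _) → h ≢ k × (∃[ v ] Joins v h k)
    }

  -- Each pair e, ē of real white edges between h and k is an edge of the
  -- graph of hexagons; a cycle of length 2 consists of two such pairs.  If v
  -- and w are the endpoints in h of real white edges from h to k, these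
  -- belong to the same pair iff w is v or v̄.
  No2Cycle : Set
  No2Cycle = ∀ h k v w → h ∈ hexagons K → k ∈ hexagons K → h ≢ k →
             Joins v h k → Joins w h k → w ≡ v ⊎ w ≡ bar v

record Proper (K : ColouredGraph n) : Set where
  field
    no-end        : ¬ HasEnd K
    two-connected : TwoConnected (hexagonGraph K)
    no-2-cycle    : No2Cycle K

data Matching : Set where
  even odd : Matching

matchingEdges : Matching → List (Fin 6 × Fin 6)
matchingEdges even = (0F , 1F) ∷ (2F , 3F) ∷ (4F , 5F) ∷ []
matchingEdges odd  = (1F , 2F) ∷ (3F , 4F) ∷ (5F , 0F) ∷ []

-- One step of a reduction, for the edge {a , b} of the matching: Q is the
-- path a′ a b b′ with a′ = mate a and b′ = mate b, and Q is a cycle of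
-- length 2 iff a′ ≡ b.

module _ (K : ColouredGraph n) (a b : Vertex n) where

  -- a′ is matched to b′.  The vertices a and b are about to be deleted;
  -- they are matched to each other so that no white edge leaves them.
  -- Nothing changes when a′ ≡ b.
  contractMate : Vertex n → Vertex n
  contractMate v =
    if ⌊ v ≟ᵛ a ⌋ then b else
    if ⌊ v ≟ᵛ b ⌋ then a else
    if ⌊ v ≟ᵛ mate K a ⌋ then mate K b else
    if ⌊ v ≟ᵛ mate K b ⌋ then mate K a else
    mate K v

  -- The rules also apply to the red edges they add, so a red edge with both
  -- ends in the interior of Q leads to one joining the ends of e_Q.
  data ContractRed : Vertex n → Vertex n → Set where
    old    : ∀ {u w} → Red K u w → ContractRed u w
    flip   : ∀ {u w} → ContractRed u w → ContractRed w u
    moved  : ∀ {u w w′} → mate K a ≢ b →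
             w ≡ a ⊎ w ≡ b → w′ ≡ mate K a ⊎ w′ ≡ mate K b → side K w′ ≡ side K w →
             ContractRed u w → ContractRed u w′
    closed : ∀ {u w} → mate K a ≡ b →
             w ≡ a ⊎ w ≡ b →
             ContractRed u w → ContractRed u (bar u)

  contract : ColouredGraph n
  contract = record
    { hexagons = hexagons K
    ; side     = side K
    ; mate     = contractMate
    ; Red      = ContractRed
    }

delete : ColouredGraph n → Fin n → ColouredGraph n
delete K h = record
  { hexagons = hexagons K - h
  ; side     = side K
  ; mate     = mate K
  ; Red      = λ u v → Red K u v × proj₁ u ≢ h × proj₁ v ≢ h
  }

-- The edges of the matching are contracted one after the other, in the graph
-- obtained so far.  So a red edge between the interiors of two of the paths
-- Q becomes a red edge between the corresponding new white edges, and a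
-- white edge with both ends in h is passed through correctly.

reduce : ColouredGraph n → Fin n × Matching → ColouredGraph n
reduce K (h , N) =
  delete (foldl (λ L (i , j) → contract L (h , i) (h , j)) K (matchingEdges N)) h

Reduction : ℕ → Set
Reduction n = List (Fin n × Matching)

reduceAll : ColouredGraph n → Reduction n → ColouredGraph n
reduceAll = foldl reduce

module _ (K : ColouredGraph n) (R : Reduction n) where

  CreatesEnd : Set
  CreatesEnd = HasEnd (reduceAll K R)

  -- The white edge at v has an endpoint in a reduced hexagon.
  Touched : Vertex n → Set
  Touched v = proj₁ v List.∈ map proj₁ R ⊎ proj₁ (mate K v) List.∈ map proj₁ R

  -- Adjacency in the subgraph whose components are the contracted paths.
  data Step : Vertex n → Vertex n → Set where
    white   : ∀ {v} → (K ∈V) v → Touched v → Step v (mate K v)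
    matched : ∀ {h N i j} → (h , N) List.∈ R →
              (i , j) List.∈ matchingEdges N ⊎ (j , i) List.∈ matchingEdges N →
              Step (h , i) (h , j)

  -- The vertices of that subgraph: each edge of a matching has its ends in
  -- a reduced hexagon, so they are the ends of the white edges in it.
  OnContracted : Vertex n → Set
  OnContracted v = (K ∈V) v × Touched v

  -- The component containing p contains the white edge at v.
  Contains : Vertex n → Vertex n → Set
  Contains p v = OnContracted v × Star Step p v

  AtMostOneDerived : Vertex n → Set
  AtMostOneDerived p = ∀ v w → Derived K v → Derived K w →
                       Contains p v → Contains p w → _On_ K w v

  Safe : Set
  Safe = ∀ p → OnContracted p → AtMostOneDerived p

ReductionOf : List (Fin n) → Set
ReductionOf {n} hs = Σ[ R ∈ Reduction n ] map proj₁ R ≡ hs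

SafelyReducible : ColouredGraph n → List (Fin n) → Set
SafelyReducible K hs = Σ[ (R , _) ∈ ReductionOf hs ] Safe K R

data Ear : Set where
  x z y : Ear

_~ᴾ_ : Ear → Ear → Set
x ~ᴾ z = ⊤
z ~ᴾ x = ⊤
z ~ᴾ y = ⊤
y ~ᴾ z = ⊤
_ ~ᴾ _ = ⊥

addEar : (G : Graph) → V G → V G → Graph
addEar G u v = record { V = V G ⊎ Ear ; _~_ = _~′_ }
  where
  HalfEdge : V G → Ear → Set
  HalfEdge a x = a ≡ u
  HalfEdge a y = a ≡ v
  HalfEdge a z = ⊥

  _~′_ : V G ⊎ Ear → V G ⊎ Ear → Set
  inj₁ a ~′ inj₁ b = Graph._~_ G a b
  inj₁ a ~′ inj₂ q = HalfEdge a q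
  inj₂ p ~′ inj₁ b = HalfEdge b p
  inj₂ p ~′ inj₂ q = p ~ᴾ q

record PAddition (K : ColouredGraph n) (K′ : ColouredGraph n′) : Set where
  field
    u v      : V (hexagonGraph K′)
    distinct : u ≢ v
    degree-u : Degree2 (hexagonGraph K′) u
    degree-v : Degree2 (hexagonGraph K′) v
    iso      : hexagonGraph K ≅ addEar (hexagonGraph K′) u v

  hexagonOf : Ear → Fin n
  hexagonOf p = proj₁ (Inverse.from (_≅_.bijection iso) (inj₂ p))

-- P sends each vertex of the ear to the corresponding hexagon of K.

earHexagons : (Ear → Fin n) → List (Fin n)
earHexagons P = P x ∷ P y ∷ P z ∷ []

module _ (K : ColouredGraph n) (P : Ear → Fin n) where

  At : Ear → Vertex n → Set
  At p v = proj₁ v ≡ P p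

  InP : Vertex n → Set
  InP v = ∃[ p ] At p v

  InXY : Vertex n → Set
  InXY v = At x v ⊎ At y v

  NoEdge : Vertex n → Set
  NoEdge v = Derived K v × (InP v ⊎ InP (mate K v))

  ExactlyOneInP : Vertex n → Set
  ExactlyOneInP v = (InP v × ¬ InP (mate K v)) ⊎ (¬ InP v × InP (mate K v))

  PObstacle : Set
  PObstacle = ∀ v → NoEdge v → ExactlyOneInP v

  WithinXY : Vertex n → Set
  WithinXY e = NoEdge e × InXY e × InXY (mate K e)

  BetweenXYAndZ : Vertex n → Set
  BetweenXYAndZ f = NoEdge f × ((InXY f × At z (mate K f)) ⊎ (At z f × InXY (mate K f)))

  LeavesFromZ : Vertex n → Set
  LeavesFromZ g = NoEdge g × ((At z g × ¬ InP (mate K g)) ⊎ (¬ InP g × At z (mate K g)))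

  record PDanger : Set where
    field
      e f g₁ g₂  : Vertex n
      e-within   : WithinXY e
      f-between  : BetweenXYAndZ f
      g₁-no-edge : NoEdge g₁
      g₂-no-edge : NoEdge g₂
      g₁-leaves  : ExactlyOneInP g₁
      g₂-leaves  : ExactlyOneInP g₂
      g₁≢g₂      : ¬ _On_ K g₂ g₁
      no-others  : ∀ v → NoEdge v →
                   _On_ K v e ⊎ _On_ K v f ⊎ _On_ K v g₁ ⊎ _On_ K v g₂

  PBad : Set
  PBad = PDanger × (∃[ e ] ∃[ g ] WithinXY e × LeavesFromZ g × RedConnected K e g)

  -- One contracted path, that of p, contains exactly the derived white edges
  -- at e and g; every other one contains at most one.
  SafeExcept : Reduction n → Vertex n → Vertex n → Set
  SafeExcept R e g = ∃[ p ]
      OnContracted K R p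
    × (∀ v → (Derived K v × Contains K R p v) ⇔ (_On_ K v e ⊎ _On_ K v g))
    × (∀ q → OnContracted K R q → ¬ Star (Step K R) p q → AtMostOneDerived K R q)

{-# OPTIONS --safe #-}

-- Each hexagon of the ear has a pair of real edges towards the left and one
-- towards the right along u x z y v, and its third pair is derived.  Once a
-- matching is chosen in each hexagon, the matching edges and the real edges
-- inside the ear form five strands, whose ends are the six derived endpoints
-- and the four exits to u and v.  Any two derived endpoints in different
-- hexagons and on different sides are the ends of a strand for some choice
-- of matchings, and then each of the other four strands has exactly one
-- derived end.  Without an obstacle some derived edge has both ends at the
-- ear; joining these by a strand gives a safe reduction.  In a danger, joining
-- an end of e to an end of g gives the contracted path with e and g.  A
-- created end would come from a red edge of K inside one contracted path,
-- and such a red edge would be an end of K or connect e to g.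

module Submission where

open import Defs
open import Data.Bool.Base using (Bool; true; false; not; if_then_else_)
open import Data.Bool.Properties using (not-involutive)
import Data.Bool.Properties as Bool
open import Data.Empty using (⊥; ⊥-elim)
open import Data.Fin.Base using (Fin; toℕ)
open import Data.Fin.Patterns using (0F; 1F; 2F; 3F; 4F; 5F)
open import Data.Fin.Properties using (_≟_; all?)
open import Data.Fin.Subset using (⁅_⁆) renaming (_∈_ to _∈ˢ_)
open import Data.Fin.Subset.Properties using (p─q⊆p)
open import Data.List.Base using (List; []; _∷_; foldl; map)
open import Data.List.Membership.Propositional using (_∈_)
open import Data.List.Relation.Unary.Any as Any using (Any; here; there)
open import Data.List.Relation.Unary.All as All using (All; []; _∷_)
open import Data.Maybe.Base using (Maybe; just; nothing)
import Data.Maybe.Properties as Maybe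
open import Data.Nat.Base using (ℕ; zero; suc; _+_; _∸_; _≤ᵇ_)
open import Data.Nat.DivMod using (_mod_)
open import Data.Product.Base using (Σ-syntax; ∃-syntax; _×_; _,_; proj₁; proj₂)
import Data.Product.Properties as Product
open import Data.Sum.Base using (_⊎_; inj₁; inj₂)
open import Data.Sum.Properties using (inj₂-injective)
open import Data.Unit.Base using (tt)
open import Data.Vec.Properties.WithK using ([]=-irrelevant)
open import Function.Bundles using (mk⇔; module Equivalence; module Inverse)
open import Relation.Binary.Construct.Closure.ReflexiveTransitive
  using (Star; ε; _◅_; _◅◅_; reverse)
open import Relation.Binary.Definitions using (DecidableEquality)
open import Relation.Binary.PropositionalEquality
open import Relation.Nullary.Decidable
  using (Dec; yes; no; map′; from-yes; _×-dec_; _⊎-dec_; _→-dec_; ¬?)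
open import Relation.Nullary.Negation using (¬_)

-- Symmetries of a hexagon

opp : Fin 6 → Fin 6
opp i = (toℕ i + 3) mod 6

sign : Fin 6 → Bool
sign 0F = true
sign 1F = false
sign 2F = true
sign 3F = false
sign 4F = true
sign 5F = false

-- The six vertices of a hexagon of the ear are labelled in cyclic order
-- D⁺ R⁻ L⁺ D⁻ R⁺ L⁻, where the white edges at L± are the real pair towards
-- the left on the path u x z y v, those at R± are the real pair towards the
-- right, those at D± are derived, and the sign is the side.

D L R : Bool → Fin 6
D s = if s then 0F else 3F
L s = if s then 2F else 5F
R s = if s then 4F else 1F

opp-D : ∀ s → opp (D s) ≡ D (not s)
opp-D true  = refl
opp-D false = refl

IsD : Fin 6 → Set
IsD i = ∃[ s ] i ≡ D s

spoke-cases : ∀ i → IsD i ⊎ (∃[ s ] i ≡ L s) ⊎ (∃[ s ] i ≡ R s)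
spoke-cases 0F = inj₁ (true , refl)
spoke-cases 1F = inj₂ (inj₂ (false , refl))
spoke-cases 2F = inj₂ (inj₁ (true , refl))
spoke-cases 3F = inj₁ (false , refl)
spoke-cases 4F = inj₂ (inj₂ (true , refl))
spoke-cases 5F = inj₂ (inj₁ (false , refl))

∀ᵇ? : {Q : Bool → Set} → (∀ s → Dec (Q s)) → Dec (∀ s → Q s)
∀ᵇ? Q? = map′ (λ { (t , f) true → t ; (t , f) false → f }) (λ q → q true , q false)
  (Q? true ×-dec Q? false)

∃ᵇ? : {Q : Bool → Set} → (∀ s → Dec (Q s)) → Dec (∃[ s ] Q s)
∃ᵇ? Q? = map′ (λ { (inj₁ q) → true , q ; (inj₂ q) → false , q })
  (λ { (true , q) → inj₁ q ; (false , q) → inj₂ q }) (Q? true ⊎-dec Q? false)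

isD? : ∀ i → Dec (IsD i)
isD? i = ∃ᵇ? λ s → i ≟ D s

partner : Matching → Fin 6 → Fin 6
partner even 0F = 1F
partner even 1F = 0F
partner even 2F = 3F
partner even 3F = 2F
partner even 4F = 5F
partner even 5F = 4F
partner odd  0F = 5F
partner odd  1F = 2F
partner odd  2F = 1F
partner odd  3F = 4F
partner odd  4F = 3F
partner odd  5F = 0F

MatchedBy : Matching → Fin 6 → Fin 6 → Set
MatchedBy N i j = (i , j) ∈ matchingEdges N ⊎ (j , i) ∈ matchingEdges N

matched⇒partner : ∀ N {i j} → MatchedBy N i j → j ≡ partner N i
matched⇒partner even (inj₁ (here refl)) = refl
matched⇒partner even (inj₁ (there (here refl))) = refl
matched⇒partner even (inj₁ (there (there (here refl)))) = refl
matched⇒partner even (inj₂ (here refl)) = refl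
matched⇒partner even (inj₂ (there (here refl))) = refl
matched⇒partner even (inj₂ (there (there (here refl)))) = refl
matched⇒partner odd  (inj₁ (here refl)) = refl
matched⇒partner odd  (inj₁ (there (here refl))) = refl
matched⇒partner odd  (inj₁ (there (there (here refl)))) = refl
matched⇒partner odd  (inj₂ (here refl)) = refl
matched⇒partner odd  (inj₂ (there (here refl))) = refl
matched⇒partner odd  (inj₂ (there (there (here refl)))) = refl

partner⇒matched : ∀ N i → MatchedBy N i (partner N i)
partner⇒matched even 0F = inj₁ (here refl)
partner⇒matched even 1F = inj₂ (here refl)
partner⇒matched even 2F = inj₁ (there (here refl))
partner⇒matched even 3F = inj₂ (there (here refl))
partner⇒matched even 4F = inj₁ (there (there (here refl)))
partner⇒matched even 5F = inj₂ (there (there (here refl)))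
partner⇒matched odd  0F = inj₂ (there (there (here refl)))
partner⇒matched odd  1F = inj₁ (here refl)
partner⇒matched odd  2F = inj₂ (here refl)
partner⇒matched odd  3F = inj₁ (there (here refl))
partner⇒matched odd  4F = inj₂ (there (here refl))
partner⇒matched odd  5F = inj₁ (there (there (here refl)))

-- Sides alternate around a hexagon, so the side `b` of the vertex numbered 0 determines all six.
hue : Bool → Fin 6 → Bool
hue b i = if sign i then b else not b

-- A dihedral relabelling of the 6-cycle, which lets each hexagon of the ear be treated in the
-- standard labels. The last field fixes the sides: `2F` is `L true`, and as soon as its image lies
-- on side `true`, all labels have the side given by `sign`.
record Symmetry : Set where
  field
    to from      : Fin 6 → Fin 6
    image        : Matching → Matching
    to-from      : ∀ i → to (from i) ≡ i
    from-to      : ∀ i → from (to i) ≡ i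
    to-opp       : ∀ i → to (opp i) ≡ opp (to i)
    to-partner   : ∀ N i → to (partner N i) ≡ partner (image N) (to i)
    to-alternate : ∀ b → hue b (to 2F) ≡ true → ∀ i → hue b (to i) ≡ sign i

∀ᴺ? : {Q : Matching → Set} → (∀ N → Dec (Q N)) → Dec (∀ N → Q N)
∀ᴺ? Q? = map′ (λ { (p , q) even → p ; (p , q) odd → q }) (λ q → q even , q odd)
  (Q? even ×-dec Q? odd)

swapMatching : Matching → Matching
swapMatching even = odd
swapMatching odd  = even

rotation : Fin 6 → Symmetry
rotation c = record
  { to           = to c
  ; from         = from c
  ; image        = image c
  ; to-from      = from-yes (all? λ c → all? λ i → to c (from c i) ≟ i) c
  ; from-to      = from-yes (all? λ c → all? λ i → from c (to c i) ≟ i) c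
  ; to-opp       = from-yes (all? λ c → all? λ i → to c (opp i) ≟ opp (to c i)) c
  ; to-partner   = from-yes (all? λ c → ∀ᴺ? λ N → all? λ i →
      to c (partner N i) ≟ partner (image c N) (to c i)) c
  ; to-alternate = from-yes (all? λ c → ∀ᵇ? λ b → (hue b (to c 2F) Bool.≟ true) →-dec
      all? λ i → hue b (to c i) Bool.≟ sign i) c
  }
  where
  to from : Fin 6 → Fin 6 → Fin 6
  -- Modulo 6 the shift is `c - 2`, so `2F` goes to `c` and `4F` to `c + 2`. The 8 in the inverse
  -- keeps the truncated subtraction exact.
  to   c i = (toℕ c + 4 + toℕ i) mod 6
  from c i = (toℕ i + 8 ∸ toℕ c) mod 6
  image : Fin 6 → Matching → Matching
  image c N = if sign c then N else swapMatching N

reflection : Fin 6 → Symmetry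
reflection c = record
  { to           = to c
  ; from         = to c
  ; image        = image c
  ; to-from      = from-yes (all? λ c → all? λ i → to c (to c i) ≟ i) c
  ; from-to      = from-yes (all? λ c → all? λ i → to c (to c i) ≟ i) c
  ; to-opp       = from-yes (all? λ c → all? λ i → to c (opp i) ≟ opp (to c i)) c
  ; to-partner   = from-yes (all? λ c → ∀ᴺ? λ N → all? λ i →
      to c (partner N i) ≟ partner (image c N) (to c i)) c
  ; to-alternate = from-yes (all? λ c → ∀ᵇ? λ b → (hue b (to c 2F) Bool.≟ true) →-dec
      all? λ i → hue b (to c i) Bool.≟ sign i) c
  }
  where
  to : Fin 6 → Fin 6 → Fin 6
  -- Again `2F` goes to `c`, but `4F` now goes to `c - 2`. For even `c` the reflection fixes two
  -- antipodal vertices and so exchanges the two matchings; for odd `c` its axis crosses two edges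
  -- and both matchings are kept.
  to c i = (toℕ c + 8 ∸ toℕ i) mod 6
  image : Fin 6 → Matching → Matching
  image c N = if sign c then swapMatching N else N

-- Distinct vertices of equal sign are two steps apart; a rotation serves one direction and a
-- reflection the other.
symmetry-through : ∀ l r → sign l ≡ sign r → l ≢ r →
                   Σ[ σ ∈ Symmetry ] Symmetry.to σ 2F ≡ l × Symmetry.to σ 4F ≡ r
symmetry-through l r s≡ l≢r with either l r s≡ l≢r
  where
  either : ∀ l r → sign l ≡ sign r → l ≢ r →
           (Symmetry.to (rotation l) 2F ≡ l × Symmetry.to (rotation l) 4F ≡ r)
         ⊎ (Symmetry.to (reflection l) 2F ≡ l × Symmetry.to (reflection l) 4F ≡ r)
  either = from-yes (all? λ l → all? λ r → (sign l Bool.≟ sign r) →-dec (¬? (l ≟ r) →-dec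
    ((Symmetry.to (rotation l) 2F ≟ l ×-dec Symmetry.to (rotation l) 4F ≟ r) ⊎-dec
     (Symmetry.to (reflection l) 2F ≟ l ×-dec Symmetry.to (reflection l) 4F ≟ r))))
... | inj₁ eqs = rotation l , eqs
... | inj₂ eqs = reflection l , eqs

-- Strands

Name : Set
Name = Ear × Fin 6

_≟ᴱ_ : DecidableEquality Ear
x ≟ᴱ x = yes refl
x ≟ᴱ z = no λ ()
x ≟ᴱ y = no λ ()
z ≟ᴱ x = no λ ()
z ≟ᴱ z = yes refl
z ≟ᴱ y = no λ ()
y ≟ᴱ x = no λ ()
y ≟ᴱ z = no λ ()
y ≟ᴱ y = yes refl

_≟ᴺ_ : DecidableEquality Name
_≟ᴺ_ = Product.≡-dec _≟ᴱ_ _≟_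

∀ᴱ? : {Q : Ear → Set} → (∀ q → Dec (Q q)) → Dec (∀ q → Q q)
∀ᴱ? Q? = map′ (λ { (a , b , c) x → a ; (a , b , c) z → b ; (a , b , c) y → c })
  (λ q → q x , q z , q y) (Q? x ×-dec Q? z ×-dec Q? y)

-- These are the real edges with both ends at the ear. Each goes from the right pair of a hexagon to
-- the left pair of the next one along x z y, and the signs differ because a white edge changes
-- sides.
inner : Name → Maybe Name
inner (x , 4F) = just (z , 5F)
inner (x , 1F) = just (z , 2F)
inner (z , 5F) = just (x , 4F)
inner (z , 2F) = just (x , 1F)
inner (z , 4F) = just (y , 5F)
inner (z , 1F) = just (y , 2F)
inner (y , 5F) = just (z , 4F)
inner (y , 2F) = just (z , 1F)
inner _        = nothing

∃ᴱ? : {Q : Ear → Set} → (∀ q → Dec (Q q)) → Dec (∃[ q ] Q q)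
∃ᴱ? Q? = map′
  (λ { (inj₁ e) → x , e ; (inj₂ (inj₁ e)) → z , e ; (inj₂ (inj₂ e)) → y , e })
  (λ { (x , e) → inj₁ e ; (z , e) → inj₂ (inj₁ e) ; (y , e) → inj₂ (inj₂ e) })
  (Q? x ⊎-dec Q? z ⊎-dec Q? y)

-- Once matchings are chosen, their edges and the inner real edges form
-- disjoint paths, the strands.  With equal signs at two hexagons of the ear
-- and the opposite sign at the third, exactly one strand joins two D-labels,
-- and every other strand has exactly one D-label.

data Pair : Set where
  xz yz xy : Pair

first second : Pair → Ear
first xz = x
first yz = y
first xy = x
second xz = z
second yz = z
second xy = y

matchingOf : Bool → Matching
matchingOf s = if s then even else odd

choice : Pair → Bool → Ear → Matching
choice xz s y = matchingOf (not s)
choice xz s _ = matchingOf s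
choice yz s x = matchingOf s
choice yz s _ = matchingOf (not s)
choice xy s z = matchingOf (not s)
choice xy s _ = matchingOf s

joined₁ joined₂ : Pair → Bool → Name
joined₁ p s = first p , D s
joined₂ p s = second p , D (not s)

module _ (N : Ear → Matching) where

  cross : Name → Name
  cross (q , i) = q , partner (N q) i

  walk  : ℕ → Name → Name
  enter : ℕ → Name → Maybe Name → Name
  walk zero    m = cross m
  walk (suc k) m = enter k (cross m) (inner (cross m))
  enter k m nothing   = m
  enter k m (just m′) = walk k m′

  -- Two further hexagons suffice, since a strand meets each hexagon at most once.
  farEnd nearEnd : Name → Name
  farEnd = walk 2
  nearEnd m with inner m
  ... | nothing = m
  ... | just m′ = farEnd m′

-- The preferred end of a strand is a D-label, and the joined strand prefers
-- joined₁.
rank : Name → ℕ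
rank (x , 0F) = 0
rank (x , 3F) = 0
rank (y , 0F) = 1
rank (y , 3F) = 1
rank (z , 0F) = 2
rank (z , 3F) = 2
rank _        = 3

∀ᴾ? : {Q : Pair → Set} → (∀ q → Dec (Q q)) → Dec (∀ q → Q q)
∀ᴾ? Q? = map′ (λ { (a , b , c) xz → a ; (a , b , c) yz → b ; (a , b , c) xy → c })
  (λ q → q xz , q yz , q xy) (Q? xz ×-dec Q? yz ×-dec Q? xy)

third : Pair → Ear
third xz = y
third yz = x
third xy = z

-- The white edges e and f of a danger, f also with its ends exchanged; the
-- strand to be contracted joins e to g, which is at joined₂.
dangerEdges : Pair → Bool → List (Name × Name)
dangerEdges p s = (joined₁ p s , (third p , D (not s)))
                ∷ ((first p , D (not s)) , (z , D s))
                ∷ ((z , D s) , (first p , D (not s)))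
                ∷ []

-- a and b cannot be on the same white edge if each first component of a
-- pair in ms is matched to the second one.
Apart : List (Name × Name) → Name → Name → Set
Apart ms a b = a ≢ b ×
  Any (λ (m , m′) → (a ≡ m × b ≢ m′) ⊎ (b ≡ m × a ≢ m′)) ms

apart? : ∀ ms a b → Dec (Apart ms a b)
apart? ms a b = ¬? (a ≟ᴺ b) ×-dec Any.any? (λ (m , m′) →
  ((a ≟ᴺ m) ×-dec ¬? (b ≟ᴺ m′)) ⊎-dec ((b ≟ᴺ m) ×-dec ¬? (a ≟ᴺ m′))) ms

-- `end` names a strand by its preferred end, hence is constant along matching edges and inner
-- edges. By `end-D` only the second end of the joined strand is not its own name. `ends-apart` will
-- keep the red edges between antipodal ends of real edges from lying in one contracted path of a
-- danger.
record StrandEnds (p : Pair) (s : Bool) : Set where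
  field
    end        : Name → Name
    end-cross  : ∀ q i → end (cross (choice p s) (q , i)) ≡ end (q , i)
    end-inner  : ∀ q i q′ i′ → inner (q , i) ≡ just (q′ , i′) → end (q′ , i′) ≡ end (q , i)
    end-D      : ∀ q t → end (q , D t) ≡ (q , D t) ⊎
                         ((q , D t) ≡ joined₂ p s × end (q , D t) ≡ joined₁ p s)
    ends-apart : second p ≡ z → ∀ q i → ¬ IsD i →
                 Apart (dangerEdges p s) (end (q , i)) (end (q , opp i))

opaque
  strandEnds : ∀ p s → StrandEnds p s
  strandEnds p s = record
    { end        = strandEnd p s
    ; end-cross  = from-yes (∀ᴾ? λ p → ∀ᵇ? λ s → ∀ᴱ? λ q → all? λ i →
        strandEnd p s (cross (choice p s) (q , i)) ≟ᴺ strandEnd p s (q , i)) p s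
    ; end-inner  = from-yes (∀ᴾ? λ p → ∀ᵇ? λ s → ∀ᴱ? λ q → all? λ i → ∀ᴱ? λ q′ → all? λ i′ →
        Maybe.≡-dec _≟ᴺ_ (inner (q , i)) (just (q′ , i′)) →-dec
        (strandEnd p s (q′ , i′) ≟ᴺ strandEnd p s (q , i))) p s
    ; end-D      = from-yes (∀ᴾ? λ p → ∀ᵇ? λ s → ∀ᴱ? λ q → ∀ᵇ? λ t →
        (strandEnd p s (q , D t) ≟ᴺ (q , D t)) ⊎-dec
        (((q , D t) ≟ᴺ joined₂ p s) ×-dec (strandEnd p s (q , D t) ≟ᴺ joined₁ p s))) p s
    ; ends-apart = from-yes (∀ᴾ? λ p → ∀ᵇ? λ s → (second p ≟ᴱ z) →-dec
        ∀ᴱ? λ q → all? λ i → ¬? (isD? i) →-dec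
        apart? (dangerEdges p s) (strandEnd p s (q , i)) (strandEnd p s (q , opp i))) p s
    }
    where
    strandEnd : Pair → Bool → Name → Name
    strandEnd p s m = if rank near ≤ᵇ rank far then near else far
      where
      near far : Name
      near = nearEnd (choice p s) m
      far  = farEnd (choice p s) m

-- The two hexagons are consecutive on the ear, so the joined strand passes through a single real
-- edge.
inner-cross-joined : ∀ p s → second p ≡ z →
  inner (cross (choice p s) (joined₁ p s)) ≡ just (cross (choice p s) (joined₂ p s))
inner-cross-joined = from-yes (∀ᴾ? λ p → ∀ᵇ? λ s → (second p ≟ᴱ z) →-dec
  Maybe.≡-dec _≟ᴺ_ (inner (cross (choice p s) (joined₁ p s)))
                   (just (cross (choice p s) (joined₂ p s))))

-- White edges and their endpoints

module WhiteEdges {n} (K : ColouredGraph n) (isPseudohex : IsPseudohex K) where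
  open IsPseudohex isPseudohex

  private
    _∈K : Vertex n → Set
    _∈K = K ∈V

  bar-involutive : (v : Vertex n) → bar (bar v) ≡ v
  bar-involutive (h , i) = cong (h ,_) (opp-involutive i)
    where
    opp-involutive : ∀ i → opp (opp i) ≡ i
    opp-involutive = from-yes (all? λ i → opp (opp i) ≟ i)

  side-hue : ∀ h → h ∈ˢ hexagons K → ∀ i → side K (h , i) ≡ hue (side K (h , 0F)) i
  side-hue h h∈ = go
    where
    twice : ∀ i → side K (next (next (h , i))) ≡ side K (h , i)
    twice i = trans (blue-bipartite (next (h , i)) h∈)
      (trans (cong not (blue-bipartite (h , i) h∈)) (not-involutive _))
    first-edge = blue-bipartite (h , 0F) h∈
    go : ∀ i → side K (h , i) ≡ hue (side K (h , 0F)) i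
    go 0F = refl
    go 1F = first-edge
    go 2F = twice 0F
    go 3F = trans (twice 1F) first-edge
    go 4F = trans (twice 2F) (twice 0F)
    go 5F = trans (twice 3F) (trans (twice 1F) first-edge)

  side-bar : ∀ v → v ∈K → side K (bar v) ≡ not (side K v)
  side-bar (h , i) h∈ = trans (side-hue h h∈ (opp i))
    (trans (hue-opp (side K (h , 0F)) i) (cong not (sym (side-hue h h∈ i))))
    where
    hue-opp : ∀ b i → hue b (opp i) ≡ not (hue b i)
    hue-opp = from-yes (∀ᵇ? λ b → all? λ i → hue b (opp i) Bool.≟ not (hue b i))

  -- The same for both ends of a white edge, as they lie on different sides.
  canon : Vertex n → Vertex n
  canon v = if side K v then v else mate K v

  canon-mate : ∀ {v} → v ∈K → canon (mate K v) ≡ canon v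
  canon-mate {v} v∈ with side K v | side K (mate K v) | mate-bipartite v v∈
  ... | true  | false | _ = mate-involutive v v∈
  ... | false | true  | _ = refl

  canon-On : ∀ v → _On_ K (canon v) v
  canon-On v with side K v
  ... | true  = inj₁ refl
  ... | false = inj₂ refl

  On-sym : ∀ {u v} → v ∈K → _On_ K u v → _On_ K v u
  On-sym v∈ (inj₁ refl) = inj₁ refl
  On-sym v∈ (inj₂ refl) = inj₂ (sym (mate-involutive _ v∈))

  On-mate : ∀ {u v} → v ∈K → _On_ K u (mate K v) → _On_ K u v
  On-mate v∈ (inj₁ eq) = inj₂ eq
  On-mate v∈ (inj₂ eq) = inj₁ (trans eq (mate-involutive _ v∈))

  On-trans : ∀ {u v w} → w ∈K → _On_ K u v → _On_ K v w → _On_ K u w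
  On-trans w∈ uv (inj₁ refl) = uv
  On-trans w∈ uv (inj₂ refl) = On-mate w∈ uv

  On⇒canon : ∀ {u v} → v ∈K → _On_ K u v → canon u ≡ canon v
  On⇒canon v∈ (inj₁ refl) = refl
  On⇒canon v∈ (inj₂ refl) = canon-mate v∈

  canon⇒On : ∀ {u v} → u ∈K → v ∈K → canon u ≡ canon v → _On_ K u v
  canon⇒On {u} {v} u∈ v∈ eq = On-trans v∈ (On-sym u∈ (canon-On u))
    (subst (λ w → _On_ K w v) (sym eq) (canon-On v))

  On-∈ : ∀ {u v} → v ∈K → _On_ K u v → u ∈K
  On-∈ v∈ (inj₁ refl) = v∈
  On-∈ v∈ (inj₂ refl) = mate-∈V _ v∈

  -- Being real belongs to the pair of opposite white edges, while `Real` refers to one of its four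
  -- endpoints; this lemma and the next move between them.
  Real-bar : ∀ {v} → Real K v → Real K (bar v)
  Real-bar {v} (opposite , permitted) =
    trans (cong (mate K) (bar-involutive v))
          (trans (sym (bar-involutive _)) (cong bar (sym opposite)))
    , λ { w u (inj₁ on) → permitted w u (inj₂ on)
        ; w u (inj₂ on) → permitted w u (inj₁ (subst (_On_ K w) (bar-involutive v) on)) }

  Real-mate : ∀ {v} → v ∈K → Real K v → Real K (mate K v)
  Real-mate {v} v∈ (opposite , permitted) =
    trans (cong (mate K) (sym opposite))
          (trans (mate-involutive (bar v) v∈) (cong bar (sym (mate-involutive v v∈))))
    , λ { w u (inj₁ on) → permitted w u (inj₁ (On-mate v∈ on))
        ; w u (inj₂ on) → permitted w u
            (inj₂ (On-mate v∈ (subst (_On_ K w) (sym opposite) on))) }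

  Real-unmate : ∀ {v} → v ∈K → Real K (mate K v) → Real K v
  Real-unmate v∈ real =
    subst (Real K) (mate-involutive _ v∈) (Real-mate (mate-∈V _ v∈) real)

  Derived-On : ∀ {u v} → _On_ K u v → Derived K v → Derived K u
  Derived-On (inj₁ refl) derived    = derived
  Derived-On (inj₂ refl) (v∈ , ¬re) = mate-∈V _ v∈ , λ real → ¬re (Real-unmate v∈ real)

  red⇒≢ : ∀ {u v} → Red K u v → u ≢ v
  red⇒≢ red refl = not-¬ (red-bipartite red)
    where
    not-¬ : ∀ {b} → b ≢ not b
    not-¬ {true}  ()
    not-¬ {false} ()

-- Component labels and created ends

-- Contraction adds a red edge only between vertices whose components already
-- have a red edge between them, so labels of components control the ends.

module Labelling {n} (K : ColouredGraph n) (isPseudohex : IsPseudohex K)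
                 {C : Set} (c : Vertex n → C)
                 (c-mate : ∀ v → (K ∈V) v → c (mate K v) ≡ c v) where
  open IsPseudohex isPseudohex

  -- `J` is a stage of the reduction. The conditions on mates range over all vertices of `K`, also
  -- the deleted ones; `delete` leaves `mate` alone and so preserves them.
  record Tracks (J : ColouredGraph n) : Set where
    field
      hexagons-⊆ : ∀ {h} → h ∈ˢ hexagons J → h ∈ˢ hexagons K
      mate-∈K    : ∀ v → (K ∈V) v → (K ∈V) (mate J v)
      mate-label : ∀ v → (K ∈V) v → c (mate J v) ≡ c v
      red-label  : ∀ {u v} → Red J u v → (K ∈V) u × (K ∈V) v ×
                   (∃[ s ] ∃[ t ] Red K s t × c s ≡ c u × c t ≡ c v)

  tracks-self : Tracks K
  tracks-self = record
    { hexagons-⊆ = λ h∈ → h∈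
    ; mate-∈K    = mate-∈V
    ; mate-label = c-mate
    ; red-label  = λ {u} {v} red → proj₁ (red-∈V red) , proj₂ (red-∈V red) ,
                                   u , v , red , refl , refl
    }

  tracks-contract : ∀ {J a b} → (K ∈V) a → (K ∈V) b → c a ≡ c b →
                    Tracks J → Tracks (contract J a b)
  tracks-contract {J} {a} {b} a∈ b∈ ca≡cb T = record
    { hexagons-⊆ = hexagons-⊆
    ; mate-∈K    = λ v v∈ → proj₁ (contracted v v∈)
    ; mate-label = λ v v∈ → proj₂ (contracted v v∈)
    ; red-label  = red
    }
    where
    open Tracks T
    contracted : ∀ v → (K ∈V) v → (K ∈V) (contractMate J a b v) × c (contractMate J a b v) ≡ c v
    contracted v v∈ with v ≟ᵛ a
    ... | yes refl = b∈ , sym ca≡cb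
    ... | no _ with v ≟ᵛ b
    ... | yes refl = a∈ , ca≡cb
    ... | no _ with v ≟ᵛ mate J a
    ... | yes refl = mate-∈K b b∈ ,
      trans (mate-label b b∈) (trans (sym ca≡cb) (sym (mate-label a a∈)))
    ... | no _ with v ≟ᵛ mate J b
    ... | yes refl = mate-∈K a a∈ ,
      trans (mate-label a a∈) (trans ca≡cb (sym (mate-label b b∈)))
    ... | no _ = mate-∈K v v∈ , mate-label v v∈

    end-label : ∀ {w} → w ≡ mate J a ⊎ w ≡ mate J b → (K ∈V) w × c w ≡ c a
    end-label (inj₁ refl) = mate-∈K a a∈ , mate-label a a∈
    end-label (inj₂ refl) = mate-∈K b b∈ , trans (mate-label b b∈) (sym ca≡cb)

    interior-label : ∀ {w} → w ≡ a ⊎ w ≡ b → c w ≡ c a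
    interior-label (inj₁ refl) = refl
    interior-label (inj₂ refl) = sym ca≡cb

    red : ∀ {u v} → ContractRed J a b u v → (K ∈V) u × (K ∈V) v ×
          (∃[ s ] ∃[ t ] Red K s t × c s ≡ c u × c t ≡ c v)
    red (old r) = red-label r
    red (flip r) with red r
    ... | u∈ , v∈ , s , t , st , s≡ , t≡ = v∈ , u∈ , t , s , red-sym st , t≡ , s≡
    -- The new end lies in the same component as the interior vertex it replaces, so the old red
    -- edge of `K` still serves.
    red (moved _ w w′ _ r) with red r
    ... | u∈ , v∈ , s , t , st , s≡ , t≡ =
      u∈ , proj₁ (end-label w′) , s , t , st , s≡ ,
      trans t≡ (trans (interior-label w) (sym (proj₂ (end-label w′))))
    -- The added edge from `u` to `bar u` is already a red edge of `K`.
    red (closed {u} _ _ r) with red r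
    ... | u∈ , _ = u∈ , u∈ , u , bar u , red-antipodal u u∈ , refl , refl

  tracks-delete : ∀ {J} h → Tracks J → Tracks (delete J h)
  tracks-delete {J} h T = record
    { hexagons-⊆ = λ k∈ → hexagons-⊆ (p─q⊆p (hexagons J) ⁅ h ⁆ k∈)
    ; mate-∈K    = mate-∈K
    ; mate-label = mate-label
    ; red-label  = λ (r , _) → red-label r
    }
    where open Tracks T

  LabelsMatched : Fin n × Matching → Set
  LabelsMatched (h , N) = h ∈ˢ hexagons K ×
    (∀ {i j} → (i , j) ∈ matchingEdges N → c (h , i) ≡ c (h , j))

  tracks-reduce : ∀ {J} hN → LabelsMatched hN → Tracks J → Tracks (reduce J hN)
  tracks-reduce (h , N) (h∈ , equal) T = tracks-delete h (contractAll (matchingEdges N) equal T)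
    where
    contractAll : ∀ {J} es → (∀ {i j} → (i , j) ∈ es → c (h , i) ≡ c (h , j)) → Tracks J →
                  Tracks (foldl (λ L (i , j) → contract L (h , i) (h , j)) J es)
    contractAll []       equal T = T
    contractAll (_ ∷ es) equal T = contractAll es (λ ij∈ → equal (there ij∈))
      (tracks-contract h∈ h∈ (equal (here refl)) T)

  tracks-reduceAll : ∀ {J} R → All LabelsMatched R → Tracks J → Tracks (reduceAll J R)
  tracks-reduceAll []       []         T = T
  tracks-reduceAll (hN ∷ R) (lm ∷ lms) T = tracks-reduceAll R lms (tracks-reduce hN lm T)

  -- In the reduced graph mated vertices have equal labels, so the red edge of `K` behind a created
  -- end has equal labels at its ends.
  created-end : ∀ R → All LabelsMatched R → CreatesEnd K R →
                ∃[ s ] ∃[ t ] Red K s t × c s ≡ c t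
  created-end R lms (v , v∈ , red) with Tracks.red-label T red
    where
    T = tracks-reduceAll R lms tracks-self
  ... | vK , _ , s , t , st , s≡ , t≡ =
    s , t , st , trans s≡ (sym (trans t≡ (Tracks.mate-label T v vK)))
    where
    T = tracks-reduceAll R lms tracks-self

  module _ (R : Reduction n)
           (c-matched : ∀ {h N i j} → (h , N) ∈ R → MatchedBy N i j → c (h , i) ≡ c (h , j)) where

    component-label : ∀ {u v} → Star (Step K R) u v → c u ≡ c v
    component-label ε                   = refl
    component-label (white v∈ _ ◅ p)    = trans (sym (c-mate _ v∈)) (component-label p)
    component-label (matched hN e ◅ p)  = trans (c-matched hN e) (component-label p)

Step-sym : ∀ {n} {K : ColouredGraph n} → IsPseudohex K → ∀ R {u v} →
           Step K R u v → Step K R v u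
Step-sym {K = K} isPseudohex R (white {v} v∈ touched) =
  subst (Step K R (mate K v)) back (white (mate-∈V v v∈) (touched′ touched))
  where
  open IsPseudohex isPseudohex
  back = mate-involutive v v∈
  touched′ : Touched K R v → Touched K R (mate K v)
  touched′ (inj₁ t) = inj₂ (subst (λ w → proj₁ w ∈ map proj₁ R) (sym back) t)
  touched′ (inj₂ t) = inj₁ t
Step-sym _ R (matched hN (inj₁ e)) = matched hN (inj₂ e)
Step-sym _ R (matched hN (inj₂ e)) = matched hN (inj₁ e)

-- The white edges at the ear in standard labels

record Layout {n} (K : ColouredGraph n) (P : Ear → Fin n) : Set where
  field
    hexagon-∈ : ∀ q → P q ∈ˢ hexagons K
    injective : ∀ {q r} → P q ≡ P r → q ≡ r
    symmetry  : Ear → Symmetry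

  at : Name → Vertex n
  at (q , i) = P q , Symmetry.to (symmetry q) i

  field
    side-at    : ∀ q i → side K (at (q , i)) ≡ sign i
    mate-inner : ∀ m {m′} → inner m ≡ just m′ → mate K (at m) ≡ at m′
    mate-outer : ∀ q i → ¬ IsD i → inner (q , i) ≡ nothing → ¬ InP K P (mate K (at (q , i)))
    real-spoke : ∀ q i → ¬ IsD i → Real K (at (q , i))
    derived-D  : ∀ q s → ¬ Real K (at (q , D s))

-- Reductions of the ear

module EarReduction {n} {K : ColouredGraph n} (isPseudohex : IsPseudohex K)
                    (no-end : ¬ HasEnd K) {P : Ear → Fin n} (Λ : Layout K P) where
  open IsPseudohex isPseudohex
  open WhiteEdges K isPseudohex
  open Layout Λ

  at-∈ : ∀ m → (K ∈V) (at m)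
  at-∈ (q , _) = hexagon-∈ q

  at-injective : ∀ {m m′} → at m ≡ at m′ → m ≡ m′
  at-injective {q , i} {q′ , i′} eq with injective (cong proj₁ eq)
  ... | refl = cong (q ,_) (trans (sym (from-to i)) (trans (cong from (cong proj₂ eq)) (from-to i′)))
    where open Symmetry (symmetry q)

  bar-at : ∀ q i → bar (at (q , i)) ≡ at (q , opp i)
  bar-at q i = cong (P q ,_) (sym (Symmetry.to-opp (symmetry q) i))

  InP? : ∀ v → Dec (InP K P v)
  InP? v = ∃ᴱ? λ q → proj₁ v ≟ P q

  named : ∀ {v} → InP K P v → ∃[ m ] v ≡ at m
  named {_ , j} (q , refl) = (q , from j) , cong (P q ,_) (sym (to-from j))
    where open Symmetry (symmetry q)

  red-mate : ∀ {u v} → (K ∈V) v → Red K u v → ¬ _On_ K u v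
  red-mate v∈ red (inj₁ u≡v)  = red⇒≢ red u≡v
  red-mate v∈ red (inj₂ refl) = no-end (_ , v∈ , red-sym red)

  -- The other end is no spoke, since the edge is not real. Bipartiteness gives its sign. In the
  -- same hexagon it would be the antipode, and the antipodal red edge would make an end of `K`.
  D-mate : ∀ q s → InP K P (mate K (at (q , D s))) →
           ∃[ r ] q ≢ r × mate K (at (q , D s)) ≡ at (r , D (not s))
  D-mate q s mate∈P with named mate∈P
  ... | (r , j) , eq with isD? j
  ... | no ¬D = ⊥-elim (derived-D q s (Real-unmate (at-∈ (q , D s))
                  (subst (Real K) (sym eq) (real-spoke r j ¬D))))
  ... | yes (t , refl) = r , q≢r , mate≡
    where
    sign-D : ∀ s → sign (D s) ≡ s
    sign-D true  = refl
    sign-D false = refl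
    t≡ : t ≡ not s
    t≡ = begin
      t                              ≡⟨ sign-D t ⟨
      sign (D t)                     ≡⟨ side-at r (D t) ⟨
      side K (at (r , D t))          ≡⟨ cong (side K) eq ⟨
      side K (mate K (at (q , D s))) ≡⟨ mate-bipartite _ (at-∈ (q , D s)) ⟩
      not (side K (at (q , D s)))    ≡⟨ cong not (trans (side-at q (D s)) (sign-D s)) ⟩
      not s                          ∎
      where open ≡-Reasoning
    mate≡ : mate K (at (q , D s)) ≡ at (r , D (not s))
    mate≡ = subst (λ t → mate K (at (q , D s)) ≡ at (r , D t)) t≡ eq
    q≢r : q ≢ r
    q≢r refl = red-mate (at-∈ (q , D s)) (red-sym (red-antipodal _ (at-∈ (q , D s))))
      (inj₂ (trans (bar-at q (D s)) (trans (cong (λ i → at (q , i)) (opp-D s)) (sym mate≡))))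

  mate-sym : ∀ {m m′} → mate K (at m) ≡ at m′ → mate K (at m′) ≡ at m
  mate-sym {m} eq = trans (cong (mate K) (sym eq)) (mate-involutive _ (at-∈ m))

  apart⇒canon≢ : ∀ {ms a b} → All (λ (m , m′) → mate K (at m) ≡ at m′) ms → Apart ms a b →
                 canon (at a) ≢ canon (at b)
  apart⇒canon≢ {ms} {a} {b} mates (a≢b , witness) eq with canon⇒On (at-∈ a) (at-∈ b) eq
  ... | inj₁ same  = a≢b (at-injective same)
  ... | inj₂ mated = go mates witness
    where
    go : ∀ {ms} → All (λ (m , m′) → mate K (at m) ≡ at m′) ms →
         ¬ Any (λ (m , m′) → (a ≡ m × b ≢ m′) ⊎ (b ≡ m × a ≢ m′)) ms
    go (known ∷ _) (here (inj₁ (refl , b≢m′))) =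
      b≢m′ (at-injective (trans (sym (mate-sym {b} (sym mated))) known))
    go (known ∷ _) (here (inj₂ (refl , a≢m′))) = a≢m′ (at-injective (trans mated known))
    go (_ ∷ mates) (there witness)             = go mates witness

  touched-at : ∀ {v} → (K ∈V) v → InP K P v ⊎ InP K P (mate K v) → ∃[ m ] _On_ K v (at m)
  touched-at v∈ (inj₁ v∈P) with named v∈P
  ... | m , eq = m , inj₁ eq
  touched-at v∈ (inj₂ v∈P) with named v∈P
  ... | m , eq = m , inj₂ (trans (sym (mate-involutive _ v∈)) (cong (mate K) eq))

  derived-at : ∀ {v} → Derived K v → InP K P v ⊎ InP K P (mate K v) →
               ∃[ q ] ∃[ t ] _On_ K v (at (q , D t))
  derived-at (v∈ , ¬real) touched with touched-at v∈ touched
  ... | (q , i) , on with isD? i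
  ... | yes (t , refl) = q , t , on
  ... | no ¬D = ⊥-elim (proj₂ (Derived-On (On-sym (at-∈ (q , i)) on) (v∈ , ¬real))
                              (real-spoke q i ¬D))

  module _ (p : Pair) (s : Bool) where

    open StrandEnds (strandEnds p s)

    chosen : Ear → Fin n × Matching
    chosen q = P q , Symmetry.image (symmetry q) (choice p s q)

    reduction : Reduction n
    reduction = chosen x ∷ chosen y ∷ chosen z ∷ []

    chosen-∈ : ∀ q → chosen q ∈ reduction
    chosen-∈ x = here refl
    chosen-∈ y = there (here refl)
    chosen-∈ z = there (there (here refl))

    ∈-chosen : ∀ {hN} → hN ∈ reduction → ∃[ q ] hN ≡ chosen q
    ∈-chosen (here eq)                 = x , eq
    ∈-chosen (there (here eq))         = y , eq
    ∈-chosen (there (there (here eq))) = z , eq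

    P-reduced : ∀ q → P q ∈ map proj₁ reduction
    P-reduced x = here refl
    P-reduced y = there (here refl)
    P-reduced z = there (there (here refl))

    reduced-P : ∀ {h} → h ∈ map proj₁ reduction → ∃[ q ] h ≡ P q
    reduced-P (here eq)                 = x , eq
    reduced-P (there (here eq))         = y , eq
    reduced-P (there (there (here eq))) = z , eq

    touched⇒InP : ∀ {v} → Touched K reduction v → InP K P v ⊎ InP K P (mate K v)
    touched⇒InP (inj₁ t) = inj₁ (reduced-P t)
    touched⇒InP (inj₂ t) = inj₂ (reduced-P t)

    -- A label is a white edge, given by its canonical endpoint. A vertex at the ear is labelled by
    -- the white edge at the preferred end of its strand; a vertex elsewhere takes the label of its
    -- mate if that is at the ear, and otherwise its own white edge.
    inside : ∀ v → Dec (InP K P v) → Vertex n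
    inside v (yes v∈P) = canon (at (end (proj₁ (named {v} v∈P))))
    inside v (no _)    = canon v

    core : Vertex n → Vertex n
    core v = inside v (InP? v)

    outside : ∀ v → Dec (InP K P v) → Vertex n
    outside v (yes _) = core v
    outside v (no _)  = core (mate K v)

    label : Vertex n → Vertex n
    label v = outside v (InP? v)

    core-at : ∀ m → core (at m) ≡ canon (at (end m))
    core-at m = go (InP? (at m))
      where
      go : ∀ d → inside (at m) d ≡ canon (at (end m))
      go (yes v∈P) = cong (λ m → canon (at (end m)))
        (sym (at-injective {m} {proj₁ (named {at m} v∈P)} (proj₂ (named {at m} v∈P))))
      go (no v∉P)  = ⊥-elim (v∉P (proj₁ m , refl))

    core-out : ∀ {v} → ¬ InP K P v → core v ≡ canon v
    core-out {v} v∉P = go (InP? v)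
      where
      go : ∀ d → inside v d ≡ canon v
      go (yes v∈P) = ⊥-elim (v∉P v∈P)
      go (no _)    = refl

    label-in : ∀ {v} → InP K P v → label v ≡ core v
    label-in {v} v∈P = go (InP? v)
      where
      go : ∀ d → outside v d ≡ core v
      go (yes _)  = refl
      go (no v∉P) = ⊥-elim (v∉P v∈P)

    label-out : ∀ {v} → ¬ InP K P v → label v ≡ core (mate K v)
    label-out {v} v∉P = go (InP? v)
      where
      go : ∀ d → outside v d ≡ core (mate K v)
      go (yes v∈P) = ⊥-elim (v∉P v∈P)
      go (no _)    = refl

    label-at : ∀ m → label (at m) ≡ canon (at (end m))
    label-at m = trans (label-in (proj₁ m , refl)) (core-at m)

    label-untouched : ∀ {v} → (K ∈V) v → ¬ InP K P v → ¬ InP K P (mate K v) →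
                      label v ≡ canon v
    label-untouched v∈ v∉P mate∉P = trans (label-out v∉P) (trans (core-out mate∉P) (canon-mate v∈))

    label-matched : ∀ {h N i j} → (h , N) ∈ reduction → MatchedBy N i j →
                    label (h , i) ≡ label (h , j)
    label-matched {i = i} {j} hN∈ edge with ∈-chosen hN∈
    ... | q , refl = begin
      label (P q , i)                       ≡⟨ cong (λ i → label (P q , i)) (to-from i) ⟨
      label (at m)                          ≡⟨ label-at m ⟩
      canon (at (end m))                    ≡⟨ cong (λ m → canon (at m)) (end-cross q (from i)) ⟨
      canon (at (end (cross (choice p s) m))) ≡⟨ label-at (cross (choice p s) m) ⟨
      label (at (cross (choice p s) m))     ≡⟨ cong (λ i → label (P q , i))
                                                    (to-partner (choice p s q) (from i)) ⟩
      label (P q , partner _ (to (from i))) ≡⟨ cong (λ i → label (P q , partner _ i)) (to-from i) ⟩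
      label (P q , partner _ i)             ≡⟨ cong (λ j → label (P q , j)) (matched⇒partner _ edge) ⟨
      label (P q , j)                       ∎
      where
      open ≡-Reasoning
      open Symmetry (symmetry q)
      m : Name
      m = q , from i

    -- A derived edge with both ends at the ear connects the strands at these ends, so their labels
    -- have to agree. `keeps` achieves this by labelling both strands with that edge.
    module _ (keeps : ∀ q t → InP K P (mate K (at (q , D t))) →
                       canon (at (end (q , D t))) ≡ canon (at (q , D t))) where

      label-mate : ∀ v → (K ∈V) v → label (mate K v) ≡ label v
      label-mate v v∈ = cases (InP? v) (InP? (mate K v))
        where
        back = mate-involutive v v∈
        both : ∀ {v} → (∃[ m ] v ≡ at m) → InP K P (mate K v) → label (mate K v) ≡ label v
        both ((q , i) , refl) mate∈P with isD? i
        ... | no ¬D = spoke (inner (q , i)) refl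
          where
          spoke : ∀ o → inner (q , i) ≡ o → label (mate K (at (q , i))) ≡ label (at (q , i))
          spoke nothing   eq = ⊥-elim (mate-outer q i ¬D eq mate∈P)
          spoke (just m′) eq = begin
            label (mate K (at (q , i))) ≡⟨ cong label (mate-inner (q , i) eq) ⟩
            label (at m′)               ≡⟨ label-at m′ ⟩
            canon (at (end m′))         ≡⟨ cong (λ m → canon (at m))
                                                (end-inner q i _ _ eq) ⟩
            canon (at (end (q , i)))    ≡⟨ label-at (q , i) ⟨
            label (at (q , i))          ∎
            where open ≡-Reasoning
        ... | yes (t , refl) with D-mate q t mate∈P
        ... | r , _ , eq = begin
          label (mate K (at (q , D t)))    ≡⟨ cong label eq ⟩
          label (at (r , D (not t)))       ≡⟨ label-at (r , D (not t)) ⟩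
          canon (at (end (r , D (not t)))) ≡⟨ keeps r (not t) (q , cong proj₁ (mate-sym eq)) ⟩
          canon (at (r , D (not t)))       ≡⟨ cong canon eq ⟨
          canon (mate K (at (q , D t)))    ≡⟨ canon-mate (at-∈ (q , D t)) ⟩
          canon (at (q , D t))             ≡⟨ keeps q t mate∈P ⟨
          canon (at (end (q , D t)))       ≡⟨ label-at (q , D t) ⟨
          label (at (q , D t))             ∎
          where open ≡-Reasoning
        cases : Dec (InP K P v) → Dec (InP K P (mate K v)) → label (mate K v) ≡ label v
        cases (yes v∈P) (yes mate∈P) = both (named v∈P) mate∈P
        cases (yes v∈P) (no mate∉P)  =
          trans (label-out mate∉P) (trans (cong core back) (sym (label-in v∈P)))
        cases (no v∉P)  (yes mate∈P) = trans (label-in mate∈P) (sym (label-out v∉P))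
        cases (no v∉P)  (no mate∉P)  = begin
          label (mate K v)         ≡⟨ label-out mate∉P ⟩
          core (mate K (mate K v)) ≡⟨ cong core back ⟩
          core v                   ≡⟨ core-out v∉P ⟩
          canon v                  ≡⟨ label-untouched v∈ v∉P mate∉P ⟨
          label v                  ∎
          where open ≡-Reasoning

      label-On : ∀ {u v} → (K ∈V) v → _On_ K u v → label u ≡ label v
      label-On v∈ (inj₁ refl) = refl
      label-On v∈ (inj₂ refl) = label-mate _ v∈

      label-edge : ∀ {v} m → _On_ K v (at m) → label v ≡ canon (at (end m))
      label-edge m on = trans (label-On (at-∈ m) on) (label-at m)

      open Labelling K isPseudohex label label-mate

      contained-label : ∀ {u v} → Contains K reduction u v → label u ≡ label v
      contained-label (_ , path) = component-label reduction label-matched path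

      labels-matched : All LabelsMatched reduction
      labels-matched = All.tabulate matched-labels
        where
        matched-labels : ∀ {hN} → hN ∈ reduction → LabelsMatched hN
        matched-labels hN∈ with ∈-chosen hN∈
        ... | q , refl = hexagon-∈ q , λ ij∈ → label-matched hN∈ (inj₁ ij∈)

      red-in-component : CreatesEnd K reduction → ∃[ t ] ∃[ u ] Red K t u × label t ≡ label u
      red-in-component = created-end reduction labels-matched

    -- The white edge at `joined₁` closes the joined strand to a cycle. Hence each derived edge at
    -- the ear is its own label, and labels are constant on components.
    safe : mate K (at (joined₁ p s)) ≡ at (joined₂ p s) → Safe K reduction
    safe mates u _ v w dv dw v⊂ w⊂ = canon⇒On (proj₁ dw) (proj₁ dv) (begin
      canon w ≡⟨ own-label dw (touched⇒InP (proj₂ (proj₁ w⊂))) ⟨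
      label w ≡⟨ contained-label keeps w⊂ ⟨
      label u ≡⟨ contained-label keeps v⊂ ⟩
      label v ≡⟨ own-label dv (touched⇒InP (proj₂ (proj₁ v⊂))) ⟩
      canon v ∎)
      where
      open ≡-Reasoning
      end-canon : ∀ q t → canon (at (end (q , D t))) ≡ canon (at (q , D t))
      end-canon q t with end-D q t
      ... | inj₁ eq = cong (λ m → canon (at m)) eq
      ... | inj₂ (eq , eq′) = begin
        canon (at (end (q , D t)))       ≡⟨ cong (λ m → canon (at m)) eq′ ⟩
        canon (at (joined₁ p s))         ≡⟨ canon-mate (at-∈ (joined₁ p s)) ⟨
        canon (mate K (at (joined₁ p s))) ≡⟨ cong canon mates ⟩
        canon (at (joined₂ p s))         ≡⟨ cong (λ m → canon (at m)) eq ⟨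
        canon (at (q , D t))             ∎
      keeps : ∀ q t → InP K P (mate K (at (q , D t))) →
               canon (at (end (q , D t))) ≡ canon (at (q , D t))
      keeps q t _ = end-canon q t
      own-label : ∀ {v} → Derived K v → InP K P v ⊎ InP K P (mate K v) → label v ≡ canon v
      own-label {v} dv touched with derived-at dv touched
      ... | q , t , on = begin
        label v                    ≡⟨ label-edge keeps (q , D t) on ⟩
        canon (at (end (q , D t))) ≡⟨ end-canon q t ⟩
        canon (at (q , D t))       ≡⟨ On⇒canon (at-∈ (q , D t)) on ⟨
        canon v                    ∎

    module Danger (joins-z : second p ≡ z)
                  (known : All (λ (m , m′) → mate K (at m) ≡ at m′) (dangerEdges p s))
                  (leaves : ¬ InP K P (mate K (at (joined₂ p s)))) where

      private
        e-end g-end : Name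
        e-end = joined₁ p s
        g-end = joined₂ p s

      keeps : ∀ q t → InP K P (mate K (at (q , D t))) →
              canon (at (end (q , D t))) ≡ canon (at (q , D t))
      keeps q t mate∈P with end-D q t
      ... | inj₁ eq       = cong (λ m → canon (at m)) eq
      ... | inj₂ (eq , _) = ⊥-elim (leaves (subst (λ m → InP K P (mate K (at m))) eq mate∈P))

      -- The cases in which v is, respectively, an end of a real edge at P, of
      -- an edge labelled by itself, or of g, whose label is e.
      data Status (v : Vertex n) : Set where
        spoke : ∀ q i → ¬ IsD i → _On_ K v (at (q , i)) → Status v
        own   : label v ≡ canon v → Status v
        on-g  : label v ≡ canon (at e-end) → _On_ K v (at g-end) → Status v

      status : ∀ {v} → (K ∈V) v → Status v
      status {v} v∈ = cases (InP? v) (InP? (mate K v))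
        where
        at-D : ∀ q t → _On_ K v (at (q , D t)) → Status v
        at-D q t on with end-D q t
        ... | inj₁ eq = own (trans (label-edge keeps (q , D t) on)
          (trans (cong (λ m → canon (at m)) eq) (sym (On⇒canon (at-∈ (q , D t)) on))))
        ... | inj₂ (eq , eq′) = on-g
          (trans (label-edge keeps (q , D t) on) (cong (λ m → canon (at m)) eq′))
          (subst (λ m → _On_ K v (at m)) eq on)
        touched : InP K P v ⊎ InP K P (mate K v) → Status v
        touched t with touched-at v∈ t
        ... | (q , i) , on with isD? i
        ...   | yes (t , refl) = at-D q t on
        ...   | no ¬D          = spoke q i ¬D on
        cases : Dec (InP K P v) → Dec (InP K P (mate K v)) → Status v
        cases (yes v∈P) _            = touched (inj₁ v∈P)
        cases (no _)    (yes mate∈P) = touched (inj₂ mate∈P)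
        cases (no v∉P)  (no mate∉P)  = own (label-untouched v∈ v∉P mate∉P)

      -- Every red edge at a real edge joins antipodal vertices, so this excludes such red edges
      -- from the interior of a component.
      spoke-label : ∀ {v q i} → ¬ IsD i → _On_ K v (at (q , i)) → label v ≢ label (bar v)
      spoke-label {v} {q} {i} ¬D on eq =
        apart⇒canon≢ known (ends-apart joins-z q i ¬D) (begin
          canon (at (end (q , i)))     ≡⟨ label-edge keeps (q , i) on ⟨
          label v                      ≡⟨ eq ⟩
          label (bar v)                ≡⟨ label-edge keeps (q , opp i) (on-bar on) ⟩
          canon (at (end (q , opp i))) ∎)
        where
        open ≡-Reasoning
        on-bar : ∀ {v} → _On_ K v (at (q , i)) → _On_ K (bar v) (at (q , opp i))
        on-bar (inj₁ refl) = inj₁ (bar-at q i)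
        on-bar (inj₂ refl) = inj₂ (trans (sym (proj₁ (real-spoke q i ¬D)))
                                         (cong (mate K) (bar-at q i)))

      module _ {e g} (derived-e : Derived K e) (derived-g : Derived K g)
               (e-at : canon e ≡ canon (at e-end)) (g-at : canon g ≡ canon (at g-end))
               (not-bad : ¬ RedConnected K e g) where

        private
          e∈ = proj₁ derived-e
          g∈ = proj₁ derived-g

          on-e : ∀ {v} → (K ∈V) v → canon v ≡ canon (at e-end) → _On_ K v e
          on-e v∈ eq = canon⇒On v∈ e∈ (trans eq (sym e-at))

          at-g⇒on-g : ∀ {v} → _On_ K v (at g-end) → _On_ K v g
          at-g⇒on-g on =
            On-trans g∈ on (canon⇒On (at-∈ g-end) g∈ (sym g-at))

        spoke-not-red : ∀ {u v q i} → ¬ IsD i → _On_ K u (at (q , i)) → Red K u v →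
                        label u ≢ label v
        spoke-not-red {u} {v} {q} {i} ¬D on red eq = spoke-label ¬D on
          (trans eq (cong label (proj₂ (real-spoke q i ¬D) u v (inj₁ on) red)))

        -- Away from real edges at the ear, a vertex is labelled by its own white edge, or by that
        -- of e if it is on g. Equal labels at a red edge then give an end of `K` or connect e to g.
        no-red-inside : ∀ {u v} → Red K u v → label u ≢ label v
        no-red-inside {u} {v} red eq = cases (status u∈) (status v∈)
          where
          u∈ = proj₁ (red-∈V red)
          v∈ = proj₂ (red-∈V red)
          cases : Status u → Status v → ⊥
          cases (spoke q i ¬D on) _ = spoke-not-red ¬D on red eq
          cases _ (spoke q i ¬D on) = spoke-not-red ¬D on (red-sym red) (sym eq)
          cases (own eu) (own ev) =
            red-mate v∈ red (canon⇒On u∈ v∈ (trans (sym eu) (trans eq ev)))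
          cases (own eu) (on-g ev von) = not-bad (u , v , red ,
            inj₁ (on-e u∈ (trans (sym eu) (trans eq ev))) , inj₂ (at-g⇒on-g von))
          cases (on-g eu uon) (own ev) = not-bad (u , v , red ,
            inj₂ (on-e v∈ (trans (sym ev) (trans (sym eq) eu))) , inj₁ (at-g⇒on-g uon))
          cases (on-g _ uon) (on-g _ von) =
            red-mate v∈ red (On-trans v∈ uon (On-sym (at-∈ g-end) von))

        no-created-end : ¬ CreatesEnd K reduction
        no-created-end ends =
          let _ , _ , red , eq = red-in-component keeps ends in no-red-inside red eq

        cross-step : ∀ m → Step K reduction (at m) (at (cross (choice p s) m))
        cross-step (q , i) = subst (λ j → Step K reduction (at (q , i)) (P q , j))
          (sym (to-partner (choice p s q) i))
          (matched (chosen-∈ q) (partner⇒matched _ (to i)))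
          where open Symmetry (symmetry q)

        mate-step : ∀ m → Step K reduction (at m) (mate K (at m))
        mate-step m = white (at-∈ m) (inj₁ (P-reduced (proj₁ m)))

        joined-strand : Star (Step K reduction) (at e-end) (at g-end)
        joined-strand = cross-step e-end
          ◅ subst (Step K reduction (at m)) (mate-inner m (inner-cross-joined p s joins-z))
                  (mate-step m)
          ◅ Step-sym isPseudohex reduction (cross-step g-end)
          ◅ ε
          where m = cross (choice p s) e-end

        reaches : ∀ m {v} → _On_ K v (at m) → Star (Step K reduction) (at m) v
        reaches m (inj₁ refl) = ε
        reaches m (inj₂ refl) = mate-step m ◅ ε

        on-contracted : ∀ m {v} → _On_ K v (at m) → OnContracted K reduction v
        on-contracted m (inj₁ refl) = at-∈ m , inj₁ (P-reduced (proj₁ m))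
        on-contracted m (inj₂ refl) = mate-∈V _ (at-∈ m) ,
          inj₂ (subst (λ v → proj₁ v ∈ map proj₁ reduction) (sym (mate-involutive _ (at-∈ m)))
                      (P-reduced (proj₁ m)))

        derived-status : ∀ {v} → Derived K v →
          label v ≡ canon v ⊎ (label v ≡ canon (at e-end) × _On_ K v (at g-end))
        derived-status dv with status (proj₁ dv)
        ... | spoke q i ¬D on =
          ⊥-elim (proj₂ (Derived-On (On-sym (at-∈ (q , i)) on) dv) (real-spoke q i ¬D))
        ... | own eq     = inj₁ eq
        ... | on-g eq on = inj₂ (eq , on)

        safe-except : SafeExcept K P reduction e g
        safe-except = at e-end , on-contracted e-end (inj₁ refl) ,
          (λ v → mk⇔ only-e-g contains) , others
          where
          only-e-g : ∀ {v} → Derived K v × Contains K reduction (at e-end) v →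
                     _On_ K v e ⊎ _On_ K v g
          only-e-g (dv , v⊂) with derived-status dv
          ... | inj₂ (_ , on) = inj₂ (at-g⇒on-g on)
          ... | inj₁ eq = inj₁ (on-e (proj₁ dv)
            (trans (sym eq) (trans (sym (contained-label keeps v⊂)) e-label)))
            where
            e-label : label (at e-end) ≡ canon (at e-end)
            e-label with derived-status (Derived-On (canon⇒On (at-∈ e-end) e∈ (sym e-at)) derived-e)
            ... | inj₁ eq       = eq
            ... | inj₂ (eq , _) = eq

          contains : ∀ {v} → _On_ K v e ⊎ _On_ K v g →
                     Derived K v × Contains K reduction (at e-end) v
          contains {v} (inj₁ on) = Derived-On on derived-e , on-contracted e-end on′ , reaches e-end on′
            where
            on′ : _On_ K v (at e-end)
            on′ = On-trans (at-∈ e-end) on (canon⇒On e∈ (at-∈ e-end) e-at)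
          contains {v} (inj₂ on) = Derived-On on derived-g , on-contracted g-end on′ ,
            joined-strand ◅◅ reaches g-end on′
            where
            on′ : _On_ K v (at g-end)
            on′ = On-trans (at-∈ g-end) on (canon⇒On g∈ (at-∈ g-end) g-at)

          others : ∀ u → OnContracted K reduction u → ¬ Star (Step K reduction) (at e-end) u →
                   AtMostOneDerived K reduction u
          -- A component containing an end of g is the exceptional one, since the joined strand
          -- leads there from `e-end`. In any other component both derived edges are their own
          -- labels.
          others u _ apart v w dv dw v⊂ w⊂ with derived-status dv | derived-status dw
          ... | inj₂ (_ , on) | _ = ⊥-elim (apart ((joined-strand ◅◅ reaches g-end on)
                                      ◅◅ reverse (Step-sym isPseudohex reduction) (proj₂ v⊂)))
          ... | _ | inj₂ (_ , on) = ⊥-elim (apart ((joined-strand ◅◅ reaches g-end on)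
                                      ◅◅ reverse (Step-sym isPseudohex reduction) (proj₂ w⊂)))
          ... | inj₁ ev | inj₁ ew = canon⇒On (proj₁ dw) (proj₁ dv)
            (trans (sym ew) (trans (sym (contained-label keeps w⊂))
              (trans (contained-label keeps v⊂) ev)))

  -- Choosing the strand to be joined

  mate-flip : ∀ {q r t} → mate K (at (q , D t)) ≡ at (r , D (not t)) →
              mate K (at (r , D (not t))) ≡ at (q , D (not (not t)))
  mate-flip {q} {r} {t} eq = subst (λ t′ → mate K (at (r , D (not t))) ≡ at (q , D t′))
    (sym (not-involutive t)) (mate-sym eq)

  -- `Pair` lists two hexagons in one order only; reading the edge from its other end reverses the
  -- sign.
  joined-pair : ∀ q {r t} → q ≢ r → mate K (at (q , D t)) ≡ at (r , D (not t)) →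
                ∃[ p ] ∃[ s ] mate K (at (joined₁ p s)) ≡ at (joined₂ p s)
  joined-pair x {z} _ eq = xz , _ , eq
  joined-pair y {z} _ eq = yz , _ , eq
  joined-pair x {y} _ eq = xy , _ , eq
  joined-pair z {x} _ eq = xz , _ , mate-flip eq
  joined-pair z {y} _ eq = yz , _ , mate-flip eq
  joined-pair y {x} _ eq = xy , _ , mate-flip eq
  joined-pair x {x} q≢q _ = ⊥-elim (q≢q refl)
  joined-pair y {y} q≢q _ = ⊥-elim (q≢q refl)
  joined-pair z {z} q≢q _ = ⊥-elim (q≢q refl)

  derived-named : ∀ {q v} → Derived K v → At K P q v → ∃[ t ] v ≡ at (q , D t)
  derived-named {q} {_ , j} (_ , ¬real) refl with isD? (Symmetry.from (symmetry q) j)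
  ... | yes (t , eq) = t ,
    cong (P q ,_) (trans (sym (to-from j)) (cong to eq))
    where open Symmetry (symmetry q)
  ... | no ¬D = ⊥-elim (¬real (subst (λ j → Real K (P q , j)) (to-from j) (real-spoke q _ ¬D)))
    where open Symmetry (symmetry q)

  no-obstacle⇒safe : ¬ PObstacle K P → SafelyReducible K (earHexagons P)
  no-obstacle⇒safe ¬obstacle
    with ∃ᴱ? (λ q → ∃ᵇ? λ t → InP? (mate K (at (q , D t))))
  ... | yes (q , t , mate∈P) with D-mate q t mate∈P
  ...   | r , q≢r , eq with joined-pair q {t = t} q≢r eq
  ...     | p , s , mates = (reduction p s , refl) , safe p s mates
  -- No derived edge has both ends at the ear, so each one there leaves it, which is an obstacle.
  no-obstacle⇒safe ¬obstacle | no none = ⊥-elim (¬obstacle obstacle)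
    where
    leaving : ∀ {v} → Derived K v → InP K P v → ¬ InP K P (mate K v)
    leaving derived (q , v∈q) mate∈P with derived-named derived v∈q
    ... | t , refl = none (q , t , mate∈P)
    obstacle : PObstacle K P
    obstacle v (derived , inj₁ v∈P)    = inj₁ (v∈P , leaving derived v∈P)
    obstacle v (derived , inj₂ mate∈P) = inj₂ ((λ v∈P → leaving derived v∈P mate∈P) , mate∈P)

  Derived-mate : ∀ {v} → Derived K v → Derived K (mate K v)
  Derived-mate = Derived-On (inj₂ refl)

  D-mate-XY : ∀ q t → InXY K P (mate K (at (q , D t))) →
              ∃[ r ] (r ≡ x ⊎ r ≡ y) × q ≢ r × mate K (at (q , D t)) ≡ at (r , D (not t))
  D-mate-XY q t (inj₁ mate∈x) with D-mate q t (x , mate∈x)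
  ... | r , q≢r , eq = r , inj₁ (injective (trans (sym (cong proj₁ eq)) mate∈x)) , q≢r , eq
  D-mate-XY q t (inj₂ mate∈y) with D-mate q t (y , mate∈y)
  ... | r , q≢r , eq = r , inj₂ (injective (trans (sym (cong proj₁ eq)) mate∈y)) , q≢r , eq

  within-ends : ∀ {e} → WithinXY K P e →
    ∃[ s ] mate K (at (x , D s)) ≡ at (y , D (not s)) × canon e ≡ canon (at (x , D s))
  within-ends ((derived , _) , inj₁ e∈x , mate∈xy) with derived-named derived e∈x
  ... | s , refl with D-mate-XY x s mate∈xy
  ...   | _ , inj₁ refl , x≢x , _ = ⊥-elim (x≢x refl)
  ...   | _ , inj₂ refl , _ , eq  = s , eq , refl
  within-ends ((derived , _) , inj₂ e∈y , mate∈xy) with derived-named derived e∈y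
  ... | t , refl with D-mate-XY y t mate∈xy
  ...   | _ , inj₁ refl , _ , eq  = not t , mate-flip eq ,
    trans (sym (canon-mate (at-∈ (y , D t)))) (cong canon eq)
  ...   | _ , inj₂ refl , y≢y , _ = ⊥-elim (y≢y refl)

  between-ends : ∀ {f} → BetweenXYAndZ K P f →
    ∃[ t ] ∃[ r ] (r ≡ x ⊎ r ≡ y) × mate K (at (z , D t)) ≡ at (r , D (not t))
  between-ends ((derived , _) , ends) = cases ends
    where
    from-z : ∀ {v} → Derived K v → At K P z v → InXY K P (mate K v) →
             ∃[ t ] ∃[ r ] (r ≡ x ⊎ r ≡ y) × mate K (at (z , D t)) ≡ at (r , D (not t))
    from-z derived v∈z mate∈xy with derived-named derived v∈z
    ... | t , refl with D-mate-XY z t mate∈xy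
    ...   | r , r∈xy , _ , eq = t , r , r∈xy , eq
    cases : _ → ∃[ t ] ∃[ r ] (r ≡ x ⊎ r ≡ y) × mate K (at (z , D t)) ≡ at (r , D (not t))
    cases (inj₁ (f∈xy , mate∈z)) = from-z (Derived-mate derived) mate∈z
      (subst (InXY K P) (sym (mate-involutive _ (proj₁ derived))) f∈xy)
    cases (inj₂ (f∈z , mate∈xy)) = from-z derived f∈z mate∈xy

  leaving-end : ∀ {g} → LeavesFromZ K P g →
    ∃[ t ] ¬ InP K P (mate K (at (z , D t))) × canon g ≡ canon (at (z , D t))
  leaving-end ((derived , _) , inj₁ (g∈z , mate∉P)) with derived-named derived g∈z
  ... | t , refl = t , mate∉P , refl
  leaving-end ((derived , _) , inj₂ (g∉P , mate∈z)) with derived-named (Derived-mate derived) mate∈z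
  ... | t , eq = t ,
    (λ v∈P → g∉P (subst (InP K P)
      (trans (cong (mate K) (sym eq)) (mate-involutive _ (proj₁ derived))) v∈P)) ,
    trans (sym (canon-mate (proj₁ derived))) (cong canon eq)

  ExceptionalReduction : Vertex n → Vertex n → Set
  ExceptionalReduction e g = Σ[ (R , _) ∈ ReductionOf (earHexagons P) ]
    ¬ CreatesEnd K R × SafeExcept K P R e g

  -- The signs are forced. As e occupies `D s` at `first p`, the edge f ends at `D (not s)` there
  -- and so at `D s` of the hexagon of `z`; this leaves `D (not s)` of that hexagon for g.
  join-e-g : ∀ p s {e g} → second p ≡ z → Derived K e → Derived K g → ¬ RedConnected K e g →
    mate K (at (joined₁ p s)) ≡ at (third p , D (not s)) → canon e ≡ canon (at (joined₁ p s)) →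
    ∃[ t ] mate K (at (z , D t)) ≡ at (first p , D (not t)) →
    ∃[ t ] ¬ InP K P (mate K (at (z , D t))) × canon g ≡ canon (at (z , D t)) →
    ExceptionalReduction e g
  join-e-g p s {e} {g} joins-z de dg ¬red e-mate e-at (t , f-mate) (u , g∉P , g-at) =
    (reduction p s , refl) ,
    no-created-end de dg e-at g-at′ ¬red , safe-except de dg e-at g-at′ ¬red
    where
    third≢z : ∀ p → second p ≡ z → third p ≢ z
    third≢z xz _ ()
    third≢z yz _ ()

    t≡s : t ≡ s
    t≡s with t Bool.≟ s
    ... | yes eq = eq
    ... | no t≢s =
      ⊥-elim (third≢z p joins-z (cong proj₁ (at-injective (trans (sym e-mate) first-z))))
      where
      first-z : mate K (at (first p , D s)) ≡ at (z , D t)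
      first-z = subst (λ s → mate K (at (first p , D s)) ≡ at (z , D t))
        (trans (cong not (Bool.¬-not t≢s)) (not-involutive s)) (mate-sym f-mate)

    u≡-s : u ≡ not s
    u≡-s = Bool.¬-not λ u≡s → g∉P
      (first p , cong proj₁ (subst (λ u → mate K (at (z , D u)) ≡ at (first p , D (not t)))
                                   (trans t≡s (sym u≡s)) f-mate))

    g-name : (z , D u) ≡ joined₂ p s
    g-name = cong₂ (λ q u → q , D u) (sym joins-z) u≡-s

    g-at′ : canon g ≡ canon (at (joined₂ p s))
    g-at′ = trans g-at (cong (λ m → canon (at m)) g-name)

    f-mate′ : mate K (at (z , D s)) ≡ at (first p , D (not s))
    f-mate′ = subst (λ t → mate K (at (z , D t)) ≡ at (first p , D (not t))) t≡s f-mate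

    open Danger p s joins-z (e-mate ∷ mate-sym f-mate′ ∷ f-mate′ ∷ [])
      (subst (λ m → ¬ InP K P (mate K (at m))) g-name g∉P)

  danger⇒exceptional : PDanger K P → ¬ PBad K P → ∀ e g → WithinXY K P e → LeavesFromZ K P g →
                       ExceptionalReduction e g
  danger⇒exceptional danger ¬bad e g within leaves =
    join (within-ends within) (between-ends (PDanger.f-between danger))
    where
    ¬red : ¬ RedConnected K e g
    ¬red red = ¬bad (danger , e , g , within , leaves , red)

    -- The joined strand starts at the end of e in the hexagon that f meets. Read from `y` instead
    -- of `x`, e starts with the opposite sign.
    join : (∃[ s ] mate K (at (x , D s)) ≡ at (y , D (not s)) × canon e ≡ canon (at (x , D s))) →
           (∃[ t ] ∃[ r ] (r ≡ x ⊎ r ≡ y) × mate K (at (z , D t)) ≡ at (r , D (not t))) →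
           ExceptionalReduction e g
    join (s , e-mate , e-at) (t , _ , inj₁ refl , f-mate) =
      join-e-g xz s refl (proj₁ (proj₁ within)) (proj₁ (proj₁ leaves)) ¬red
        e-mate e-at (t , f-mate) (leaving-end leaves)
    join (s , e-mate , e-at) (t , _ , inj₂ refl , f-mate) =
      join-e-g yz (not s) refl (proj₁ (proj₁ within)) (proj₁ (proj₁ leaves)) ¬red
        (mate-flip e-mate)
        (trans e-at (trans (sym (canon-mate (at-∈ (x , D s)))) (cong canon e-mate)))
        (t , f-mate) (leaving-end leaves)

-- Real edges at one hexagon

-- A white edge at the third pair with both ends in the hexagon would join
-- opposite vertices, and so be an end of K; a real one leaving the hexagon
-- would give a cycle of length 2.

module HexagonSpokes {n} {K : ColouredGraph n} (isPseudohex : IsPseudohex K)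
                     (proper : Proper K) where
  open IsPseudohex isPseudohex
  open Proper proper
  open WhiteEdges K isPseudohex

  record Spokes (h k l : Fin n) : Set where
    field
      symmetry  : Symmetry
    open Symmetry symmetry public
    field
      side-to   : ∀ i → side K (h , to i) ≡ sign i
      joins-L   : ∀ s → Joins K (h , to (L s)) h k
      joins-R   : ∀ s → Joins K (h , to (R s)) h l
      derived-D : ∀ s → ¬ Real K (h , to (D s))

  Joins-bar : ∀ {v h k} → Joins K v h k → Joins K (bar v) h k
  Joins-bar (real , v∈h , mate∈k) =
    Real-bar real , v∈h , trans (cong proj₁ (proj₁ real)) mate∈k

  -- The two ends in `h` of a real pair are antipodal, hence on different sides.
  Joins-side : ∀ {v h k} → h ∈ˢ hexagons K → Joins K v h k →
               ∃[ i ] Joins K (h , i) h k × side K (h , i) ≡ true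
  Joins-side {_ , i} {h} h∈ joins@(_ , refl , _) with side K (h , i) in eq
  ... | true  = i , joins , eq
  ... | false = opp i , Joins-bar joins , trans (side-bar (h , i) h∈) (cong not eq)

  -- The ends on side `true` of the two real pairs have equal sign, and they differ because `k` and
  -- `l` do. A symmetry therefore takes `2F` and `4F` to them, and antipodes give `5F` and `1F`.
  spokes : ∀ {h k l v w} → h ∈ˢ hexagons K → h ≢ k → h ≢ l → k ≢ l →
           Joins K v h k → Joins K w h l →
           (∀ {u m} → m ∈ˢ hexagons K → h ≢ m → Joins K u h m → m ≡ k ⊎ m ≡ l) →
           Spokes h k l
  spokes {h} {k} {l} h∈ h≢k h≢l k≢l joins-k joins-l only
    with Joins-side h∈ joins-k | Joins-side h∈ joins-l
  ... | i , to-k , side-i | j , to-l , side-j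
    with symmetry-through i j same-sign i≢j
    where
    sign-hue : ∀ b i j → hue b i ≡ true → hue b j ≡ true → sign i ≡ sign j
    sign-hue = from-yes (∀ᵇ? λ b → all? λ i → all? λ j → (hue b i Bool.≟ true) →-dec
      ((hue b j Bool.≟ true) →-dec (sign i Bool.≟ sign j)))
    same-sign : sign i ≡ sign j
    same-sign = sign-hue (side K (h , 0F)) i j (trans (sym (side-hue h h∈ i)) side-i)
                                               (trans (sym (side-hue h h∈ j)) side-j)
    i≢j : i ≢ j
    i≢j refl = k≢l (trans (sym (proj₂ (proj₂ to-k))) (proj₂ (proj₂ to-l)))
  ... | σ , refl , refl = record
    { symmetry  = σ
    ; side-to   = side-to
    ; joins-L   = joins-L
    ; joins-R   = joins-R
    ; derived-D = derived-D
    }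
    where
    open Symmetry σ
    side-to : ∀ i → side K (h , to i) ≡ sign i
    side-to i = trans (side-hue h h∈ (to i))
      (to-alternate (side K (h , 0F)) (trans (sym (side-hue h h∈ (to 2F))) side-i) i)
    joins-L : ∀ s → Joins K (h , to (L s)) h k
    joins-L true  = to-k
    joins-L false = subst (λ i → Joins K (h , i) h k) (sym (to-opp 2F)) (Joins-bar to-k)
    joins-R : ∀ s → Joins K (h , to (R s)) h l
    joins-R true  = to-l
    joins-R false = subst (λ i → Joins K (h , i) h l) (sym (to-opp 4F)) (Joins-bar to-l)
    to-injective : ∀ {i j} → to i ≡ to j → i ≡ j
    to-injective {i} {j} eq = trans (sym (from-to i)) (trans (cong from eq) (from-to j))
    not-from : ∀ {v m} s → Joins K v h m → h ≢ m → mate K (h , to (D s)) ≢ v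
    not-from {v} s (_ , _ , mate∈m) h≢m eq = h≢m (begin
      h                                      ≡⟨ cong proj₁ (mate-involutive (h , to (D s)) h∈) ⟨
      proj₁ (mate K (mate K (h , to (D s)))) ≡⟨ cong (λ v → proj₁ (mate K v)) eq ⟩
      proj₁ (mate K v)                       ≡⟨ mate∈m ⟩
      _                                      ∎)
      where open ≡-Reasoning
    not-antipodal : ∀ s → mate K (h , to (D s)) ≢ (h , to (D (not s)))
    not-antipodal s eq = no-end ((h , to (D s)) , h∈ , subst (Red K (h , to (D s)))
      (trans (cong (h ,_) (trans (sym (to-opp (D s))) (cong to (opp-D s)))) (sym eq))
      (red-antipodal _ h∈))
    not-internal : ∀ s j → mate K (h , to (D s)) ≢ (h , to j)
    not-internal s j eq with spoke-cases j
    ... | inj₂ (inj₁ (t , refl)) = not-from s (joins-L t) h≢k eq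
    ... | inj₂ (inj₂ (t , refl)) = not-from s (joins-R t) h≢l eq
    ... | inj₁ (t , refl) with t Bool.≟ s
    ...   | no t≢s   = not-antipodal s (trans eq (cong (λ t → h , to (D t)) (Bool.¬-not t≢s)))
    -- Here the vertex would be its own mate.
    ...   | yes refl = Bool.not-¬ refl (trans (cong (side K) (sym eq)) (mate-bipartite _ h∈))
    no-second : ∀ {v m} s → h ≢ m → m ∈ˢ hexagons K →
                Joins K (h , to v) h m → Joins K (h , to (D s)) h m → D s ≡ v ⊎ D s ≡ opp v
    no-second {v} {m} s h≢m m∈ joins-v joins-D with no-2-cycle h m _ _ h∈ m∈ h≢m joins-v joins-D
    ... | inj₁ eq = inj₁ (to-injective (cong proj₂ eq))
    ... | inj₂ eq = inj₂ (to-injective (trans (cong proj₂ eq) (sym (to-opp v))))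
    derived-D : ∀ s → ¬ Real K (h , to (D s))
    derived-D s real with proj₁ (mate K (h , to (D s))) ≟ h
    ... | yes m≡h = not-internal s (from (proj₂ (mate K (h , to (D s)))))
      (cong₂ _,_ m≡h (sym (to-from _)))
    ... | no m≢h with only (mate-∈V _ h∈) (λ h≡m → m≢h (sym h≡m)) (real , refl , refl)
    ...   | inj₁ m≡k = D≢L s (no-second s h≢k (subst (_∈ˢ hexagons K) m≡k (mate-∈V _ h∈))
                                to-k (real , refl , m≡k))
      where
      D≢L : ∀ s → ¬ (D s ≡ 2F ⊎ D s ≡ opp 2F)
      D≢L true  (inj₁ ())
      D≢L true  (inj₂ ())
      D≢L false (inj₁ ())
      D≢L false (inj₂ ())
    ...   | inj₂ m≡l = D≢R s (no-second s h≢l (subst (_∈ˢ hexagons K) m≡l (mate-∈V _ h∈))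
                                to-l (real , refl , m≡l))
      where
      D≢R : ∀ s → ¬ (D s ≡ 4F ⊎ D s ≡ opp 4F)
      D≢R true  (inj₁ ())
      D≢R true  (inj₂ ())
      D≢R false (inj₁ ())
      D≢R false (inj₂ ())

-- The layout obtained from the addition of the ear

module EarLayout {n n′} {K : ColouredGraph n} {K′ : ColouredGraph n′} (isPseudohex : IsPseudohex K)
         (proper : Proper K) (A : PAddition K K′) where
  open IsPseudohex isPseudohex
  open Proper proper
  open WhiteEdges K isPseudohex
  open HexagonSpokes isPseudohex proper
  open PAddition A
  open _≅_ iso

  private
    H : Graph
    H = addEar (hexagonGraph K′) u v
    open Graph H using (_~_)
    module B = Inverse bijection

  hexagon : Graph.V H → Fin n
  hexagon a = proj₁ (B.from a)

  hexagon-∈K : ∀ a → hexagon a ∈ˢ hexagons K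
  hexagon-∈K a = proj₂ (B.from a)

  hexagon-injective : ∀ {a b} → hexagon a ≡ hexagon b → a ≡ b
  hexagon-injective {a} {b} eq = begin
    a               ≡⟨ B.strictlyInverseˡ a ⟨
    B.to (B.from a) ≡⟨ cong B.to (vertex-≡ eq) ⟩
    B.to (B.from b) ≡⟨ B.strictlyInverseˡ b ⟩
    b               ∎
    where
    open ≡-Reasoning
    -- Membership proofs are unique, so a hexagon determines a vertex of the graph of hexagons.
    vertex-≡ : ∀ {a b : ∃[ h ] h ∈ˢ hexagons K} → proj₁ a ≡ proj₁ b → a ≡ b
    vertex-≡ {h , h∈} {_ , h∈′} refl = cong (h ,_) ([]=-irrelevant h∈ h∈′)

  adjacent⇒joins : ∀ {a b} → a ~ b → hexagon a ≢ hexagon b × (∃[ w ] Joins K w (hexagon a) (hexagon b))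
  adjacent⇒joins {a} {b} a~b = Equivalence.from (adjacency (B.from a) (B.from b))
    (subst₂ _~_ (sym (B.strictlyInverseˡ a)) (sym (B.strictlyInverseˡ b)) a~b)

  joins⇒adjacent : ∀ {a m w} → m ∈ˢ hexagons K → hexagon a ≢ m → Joins K w (hexagon a) m →
                   ∃[ b ] a ~ b × m ≡ hexagon b
  joins⇒adjacent {a} {m} {w} m∈ a≢m joins = B.to (m , m∈) ,
    subst (_~ B.to (m , m∈)) (B.strictlyInverseˡ a)
      (Equivalence.to (adjacency (B.from a) (m , m∈)) (a≢m , w , joins)) ,
    cong proj₁ (sym (B.strictlyInverseʳ (m , m∈)))

  leftOf rightOf : Ear → Graph.V H
  leftOf x = inj₁ u
  leftOf z = inj₂ x
  leftOf y = inj₂ z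
  rightOf x = inj₂ z
  rightOf z = inj₂ y
  rightOf y = inj₁ v

  ~-leftOf : ∀ q → inj₂ q ~ leftOf q
  ~-leftOf x = refl
  ~-leftOf z = tt
  ~-leftOf y = tt

  ~-rightOf : ∀ q → inj₂ q ~ rightOf q
  ~-rightOf x = tt
  ~-rightOf z = tt
  ~-rightOf y = refl

  neighbours : ∀ q {a} → inj₂ q ~ a → a ≡ leftOf q ⊎ a ≡ rightOf q
  neighbours x {inj₁ _} refl = inj₁ refl
  neighbours x {inj₂ z} _    = inj₂ refl
  neighbours z {inj₂ x} _    = inj₁ refl
  neighbours z {inj₂ y} _    = inj₂ refl
  neighbours y {inj₂ z} _    = inj₁ refl
  neighbours y {inj₁ _} refl = inj₂ refl

  leftOf≢rightOf : ∀ q → leftOf q ≢ rightOf q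
  leftOf≢rightOf x ()
  leftOf≢rightOf z ()
  leftOf≢rightOf y ()

  opaque
    ear-spokes : ∀ q → Spokes (hexagonOf q) (hexagon (leftOf q)) (hexagon (rightOf q))
    ear-spokes q with adjacent⇒joins {inj₂ q} (~-leftOf q) | adjacent⇒joins {inj₂ q} (~-rightOf q)
    ... | q≢l , _ , joins-l | q≢r , _ , joins-r =
      spokes (hexagon-∈K (inj₂ q)) q≢l q≢r
        (λ eq → leftOf≢rightOf q (hexagon-injective eq)) joins-l joins-r only
      where
      only : ∀ {w m} → m ∈ˢ hexagons K → hexagonOf q ≢ m → Joins K w (hexagonOf q) m →
             m ≡ hexagon (leftOf q) ⊎ m ≡ hexagon (rightOf q)
      only m∈ q≢m joins with joins⇒adjacent {inj₂ q} m∈ q≢m joins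
      ... | b , q~b , refl with neighbours q {b} q~b
      ...   | inj₁ refl = inj₁ refl
      ...   | inj₂ refl = inj₂ refl

  private
    module S q = Spokes (ear-spokes q)

    at : Name → Vertex n
    at (q , i) = hexagonOf q , S.to q i

    at-∈ : ∀ m → (K ∈V) (at m)
    at-∈ (q , _) = hexagon-∈K (inj₂ q)

  -- Without cycles of length 2 the real edge must end in the left pair of `r`, and its side selects
  -- one of the two antipodal vertices there.
  link : ∀ {q r} → rightOf q ≡ inj₂ r → leftOf r ≡ inj₂ q → ∀ s →
         mate K (at (q , R s)) ≡ at (r , L (not s))
  link {q} {r} right left s = by-side which
    where
    w = mate K (at (q , R s))
    joins = S.joins-R q s
    r≢q : hexagonOf r ≢ hexagonOf q
    r≢q = subst (λ a → hexagonOf r ≢ hexagon a) left (proj₁ (adjacent⇒joins {inj₂ r} (~-leftOf r)))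
    joins-w : Joins K w (hexagonOf r) (hexagonOf q)
    joins-w = Real-mate (at-∈ (q , R s)) (proj₁ joins) ,
      trans (proj₂ (proj₂ joins)) (cong hexagon right) ,
      cong proj₁ (mate-involutive _ (at-∈ (q , R s)))
    joins-L : Joins K (at (r , L (not s))) (hexagonOf r) (hexagonOf q)
    joins-L = subst (Joins K (at (r , L (not s))) (hexagonOf r)) (cong hexagon left)
                    (S.joins-L r (not s))
    which : w ≡ at (r , L (not s)) ⊎ w ≡ bar (at (r , L (not s)))
    which = no-2-cycle _ _ _ _ (hexagon-∈K (inj₂ r)) (hexagon-∈K (inj₂ q)) r≢q joins-L joins-w
    same-side : ∀ s → not (sign (R s)) ≡ sign (L (not s))
    same-side true  = refl
    same-side false = refl
    side-w : side K w ≡ side K (at (r , L (not s)))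
    side-w = begin
      side K w                       ≡⟨ mate-bipartite _ (at-∈ (q , R s)) ⟩
      not (side K (at (q , R s)))    ≡⟨ cong not (S.side-to q (R s)) ⟩
      not (sign (R s))               ≡⟨ same-side s ⟩
      sign (L (not s))               ≡⟨ S.side-to r (L (not s)) ⟨
      side K (at (r , L (not s)))    ∎
      where open ≡-Reasoning
    by-side : w ≡ at (r , L (not s)) ⊎ w ≡ bar (at (r , L (not s))) → w ≡ at (r , L (not s))
    by-side (inj₁ eq) = eq
    by-side (inj₂ eq) = ⊥-elim (Bool.not-¬ side-w
      (trans (cong (side K) eq) (side-bar _ (at-∈ (r , L (not s))))))

  layout : Layout K hexagonOf
  layout = record
    { hexagon-∈  = λ q → hexagon-∈K (inj₂ q)
    ; injective  = λ eq → inj₂-injective (hexagon-injective eq)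
    ; symmetry   = S.symmetry
    ; side-at    = S.side-to
    ; mate-inner = mate-inner
    ; mate-outer = mate-outer
    ; real-spoke = real-spoke
    ; derived-D  = S.derived-D
    }
    where
    back : ∀ {m m′} → mate K (at m) ≡ at m′ → mate K (at m′) ≡ at m
    back {m} eq = trans (cong (mate K) (sym eq)) (mate-involutive _ (at-∈ m))
    mate-inner : ∀ m {m′} → inner m ≡ just m′ → mate K (at m) ≡ at m′
    mate-inner (x , 4F) refl = link {x} {z} refl refl true
    mate-inner (x , 1F) refl = link {x} {z} refl refl false
    mate-inner (z , 4F) refl = link {z} {y} refl refl true
    mate-inner (z , 1F) refl = link {z} {y} refl refl false
    mate-inner (z , 5F) refl = back {x , 4F} (link {x} {z} refl refl true)
    mate-inner (z , 2F) refl = back {x , 1F} (link {x} {z} refl refl false)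
    mate-inner (y , 5F) refl = back {z , 4F} (link {z} {y} refl refl true)
    mate-inner (y , 2F) refl = back {z , 1F} (link {z} {y} refl refl false)
    -- The spokes without an inner edge are the left ones of `x` and the right ones of `y`; they
    -- lead to the hexagons of `u` and `v`.
    mate-outer : ∀ q i → ¬ IsD i → inner (q , i) ≡ nothing →
                 ¬ InP K hexagonOf (mate K (at (q , i)))
    mate-outer q i ¬D none (r , mate∈r) with spoke-cases i
    ... | inj₁ isD = ¬D isD
    ... | inj₂ (inj₁ (s , refl)) = outer-L q s none
      (hexagon-injective (trans (sym (proj₂ (proj₂ (S.joins-L q s)))) mate∈r))
      where
      outer-L : ∀ q s → inner (q , L s) ≡ nothing → leftOf q ≢ inj₂ r
      outer-L x _     _  ()
      outer-L z true  () _
      outer-L z false () _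
      outer-L y true  () _
      outer-L y false () _
    ... | inj₂ (inj₂ (s , refl)) = outer-R q s none
      (hexagon-injective (trans (sym (proj₂ (proj₂ (S.joins-R q s)))) mate∈r))
      where
      outer-R : ∀ q s → inner (q , R s) ≡ nothing → rightOf q ≢ inj₂ r
      outer-R y _     _  ()
      outer-R z true  () _
      outer-R z false () _
      outer-R x true  () _
      outer-R x false () _
    real-spoke : ∀ q i → ¬ IsD i → Real K (at (q , i))
    real-spoke q i ¬D with spoke-cases i
    ... | inj₁ isD               = ⊥-elim (¬D isD)
    ... | inj₂ (inj₁ (s , refl)) = proj₁ (S.joins-L q s)
    ... | inj₂ (inj₂ (s , refl)) = proj₁ (S.joins-R q s)

mainTheorem5 : ∀ {n n′ : ℕ} (K : ColouredGraph n) (K′ : ColouredGraph n′) →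
    IsPseudohex K → IsPseudohex K′ → Proper K → Proper K′ →
    (A : PAddition K K′) →
    let P = PAddition.hexagonOf A in
    (¬ PObstacle K P → ¬ PDanger K P → SafelyReducible K (earHexagons P))
    × (PDanger K P → ¬ PBad K P →
    ∀ e g → WithinXY K P e → LeavesFromZ K P g →
    Σ[ (R , _) ∈ ReductionOf (earHexagons P) ]
    ¬ CreatesEnd K R × SafeExcept K P R e g)
mainTheorem5 K K′ isPseudohex _ proper _ A =
  (λ ¬obstacle _ → no-obstacle⇒safe ¬obstacle) , danger⇒exceptional
  where open EarReduction isPseudohex (Proper.no-end proper) (EarLayout.layout isPseudohex proper A)
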